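{- Let $a$, $b$, $c$ be positive integers with $\gcd(a,b)=\gcd(b,c)=\gcd(c,a)=1$. Put $\alpha=\frac{a+b+c}{2}$, $\beta=2abc$, and $$M=\left\lfloor \frac{(2\alpha\beta-1)^2-4\alpha^2}{4\beta}+\alpha\right\rfloor+1.$$ For a natural number $k$ define $$\gamma_k=\left\lfloor \sqrt{\beta(k+\alpha)+\alpha^2}-\alpha\right\rfloor,\qquad \delta_k=\left\lfloor \sqrt{\beta(k-\alpha)+\alpha^2}-\alpha\right\rfloor.$$ Let $R_k(a,b,c)$ be the set of all integers $n$ such that the equation $ax+by+cz=n$ has exactly $k$ solutions $(x,y,z)$ in nonnegative integers. Suppose $k\ge M$. If $\gamma_k=\delta_k$, then $R_k(a,b,c)=\emptyset$. If $\gamma_k\neq\delta_k$, then $R_k(a,b,c)=\{\gamma_k\}$ when the equation $ax+by+cz=\gamma_k$ has exactly $k$ solutions in nonnegative integers, and $R_k(a,b,c)=\emptyset$ otherwise. -}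

module Defs where

open import Data.Nat as ℕ using (ℕ; zero; suc; NonZero) renaming (_+_ to _+ℕ_; _*_ to _*ℕ_)
open import Data.Nat.Properties using (m*n≢0)
open import Data.Integer as ℤ using (ℤ; +_; -[1+_])
open import Data.Rational as ℚ using (ℚ; _/_; floor; 0ℚ; 1ℚ; _+_; _-_; _*_; _≤_; _<_)
open import Data.List using (List; length; filter; upTo; concatMap; map)
open import Data.Product using (_×_; _,_)
open import Data.Sum using (_⊎_)
open import Data.Nat using (_≟_)
open import Relation.Binary.PropositionalEquality using (_≡_)

ℕ→ℚ : ℕ → ℚ
ℕ→ℚ n = + n / 1

ℤ→ℚ : ℤ → ℚ
ℤ→ℚ z = z / 1

α : ℕ → ℕ → ℕ → ℚ
α a b c = + (a +ℕ b +ℕ c) / 2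

β : ℕ → ℕ → ℕ → ℚ
β a b c = ℕ→ℚ (2 *ℕ a *ℕ b *ℕ c)

M : (a b c : ℕ) → .{{NonZero a}} → .{{NonZero b}} → .{{NonZero c}} → ℤ
M a b c = floor (((t - 1ℚ) * (t - 1ℚ) - ℕ→ℚ 4 * α a b c * α a b c) * inv4β + α a b c) ℤ.+ + 1
  where
  t : ℚ
  t = ℕ→ℚ 2 * α a b c * β a b c
  inv4β : ℚ
  inv4β = _/_ (+ 1) (8 *ℕ a *ℕ b *ℕ c) {{m*n≢0 (8 *ℕ a *ℕ b) c {{m*n≢0 (8 *ℕ a) b {{m*n≢0 8 a}}}}}}

-- "g = ⌊ √X - α ⌋", written out: X ≥ 0 and  g ≤ √X - α < g + 1,
-- i.e. g + α ≤ √X  and  √X < g + 1 + α  (with √X the nonnegative square root).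
IsFloorSqrtMinus : ℚ → ℚ → ℤ → Set
IsFloorSqrtMinus X a g =
  (0ℚ ≤ X)
  × ((G ≤ 0ℚ ⊎ G * G ≤ X)
  × (0ℚ < G + 1ℚ × X < (G + 1ℚ) * (G + 1ℚ)))
  where
  G : ℚ
  G = ℤ→ℚ g + a

IsGamma : ℕ → ℕ → ℕ → ℕ → ℤ → Set
IsGamma a b c k g =
  IsFloorSqrtMinus (β a b c * (ℕ→ℚ k + α a b c) + α a b c * α a b c) (α a b c) g

IsDelta : ℕ → ℕ → ℕ → ℕ → ℤ → Set
IsDelta a b c k d =
  IsFloorSqrtMinus (β a b c * (ℕ→ℚ k - α a b c) + α a b c * α a b c) (α a b c) d

triples : ℕ → List (ℕ × ℕ × ℕ)
triples n = concatMap (λ x → concatMap (λ y → map (λ z → (x , y , z)) (upTo (suc n))) (upTo (suc n))) (upTo (suc n))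

-- number of solutions (x,y,z) ∈ ℕ³ of a x + b y + c z = n, for n ∈ ℕ
-- (for positive a,b,c every solution has x,y,z ≤ n, so enumerating triples n is exhaustive)
numSolℕ : ℕ → ℕ → ℕ → ℕ → ℕ
numSolℕ a b c n = length (filter (λ { (x , y , z) → (a *ℕ x +ℕ b *ℕ y +ℕ c *ℕ z) ≟ n }) (triples n))

numSol : ℕ → ℕ → ℕ → ℤ → ℕ
numSol a b c (+ n) = numSolℕ a b c n
numSol a b c -[1+ n ] = 0

InR : ℕ → ℕ → ℕ → ℕ → ℤ → Set
InR a b c k n = numSol a b c n ≡ k

{-# OPTIONS --safe #-}

-- Write N(n) for the number of solutions and n = a q + s with s < a.  Fixing x, the number T of
-- solutions of b y + c z = m satisfies b c T = m + b c - b u - c v, where u < c and v < b are the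
-- residues of m / b mod c and of m / c mod b.  When m runs through s, s + a, ..., n, the values u
-- are distinct in every window of length c, so that Σ u differs from its mean (c - 1) / 2 per term by
-- at most c² / 8; likewise for v.  Summation gives
--   2abc N(n) = n (n + a + b + c) + (a - s)(s + b + c) + error,  |error| ≤ abc (b + c) / 4,
-- whence -α ≤ N(n) - n (n + 2α) / β < α.  In terms of square roots this says δ_k < n ≤ γ_k
-- whenever N(n) = k, and k ≥ M forces γ_k ≤ δ_k + 1.
module Submission where

import Data.Nat.Properties

-- The remainder (a - s)(s + b + c) is nonnegative, so the lower estimate simply drops it. The upper
-- estimate must absorb it, and spends on it the slack between abc (b + c) / 4 and αβ = abc (a + b +
-- c). Completing the square turns the two estimates into β (N(n) - α) + α² < (n + α)² ≤ β (N(n) +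
-- α) + α². The strict side is the one that gives δ_k < n, and so leaves no n at all when γ_k = δ_k.
-- Origin of M: put y = β (k - α) + α², the radicand of δ_k. Then k ≥ M amounts to 4y > (2αβ - 1)²,
-- that is 2√y + 1 > 2αβ, so (√y + 1)² exceeds y + 2αβ, the radicand of γ_k. The two roots are less
-- than 1 apart, hence their floors at most 1 apart. The counting takes place in ℕ: fractions are
-- multiplied out and every subtracted term is moved to the other side, which explains the shape of
-- most statements.

module Counting where

  open import Defs using (numSolℕ; triples)
  open import Algebra.Properties.Semiring.Sum Data.Nat.Properties.+-*-semiring
    using (sum; sum-remove; sum-cong-≗; ∑-distrib-+; *-distribˡ-sum)
  open import Data.Bool using (if_then_else_)
  open import Data.Fin using (Fin; toℕ; fromℕ<)
  open import Data.Fin.Properties as Fin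
    using (pigeonhole; punchIn-injective; toℕ-injective; toℕ<n; fromℕ<-injective; any?)
  open import Data.List using (List; length; filter; concatMap; applyUpTo; upTo; map; _++_)
  open import Data.List.Properties using (filter-++; length-++)
  open import Data.Nat
  open import Data.Nat.Coprimality using (Coprime; coprime-divisor; coprime-Bézout)
  open import Data.Nat.Divisibility using (_∣_; _∤_; divides; ∣m+n∣m⇒∣n; ∣m∣n⇒∣m+n; m∣m*n; n∣m*n; >⇒∤)
  open import Data.Nat.DivMod using (_/_; _%_; m≡m%n+[m/n]*n; m%n<n; m/n*n≡m)
  open import Data.Nat.GCD using (module Bézout)
  open import Data.Nat.Induction using (<-wellFounded)
  open import Data.Nat.Properties
  open import Data.Nat.Tactic.RingSolver using (solve-∀)
  open import Data.Product using (∃; ∃₂; _,_; _×_; proj₁; proj₂)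
  open import Data.Sum using (inj₁; inj₂)
  open import Data.Vec.Functional using (removeAt)
  open import Function using (_∘_; id; Injective)
  open import Induction.WellFounded using (Acc; acc)
  open import Level using (0ℓ)
  open import Relation.Binary.Definitions using (tri<; tri≈; tri>)
  open import Relation.Binary.PropositionalEquality
  open import Relation.Nullary using (Dec; yes; no; contradiction; does; ¬_)
  open import Relation.Unary using (Pred; Decidable)

  -- Sums of sequences that are injective on windows

  -- Routed through `Fin` so that the semiring sum lemmas apply, above all `sum-remove`, which takes
  -- out an arbitrary index.
  ∑< : ℕ → (ℕ → ℕ) → ℕ
  ∑< n f = sum {n} (f ∘ toℕ)

  injective⇒large-value : ∀ {r} (f : Fin (suc r) → ℕ) → Injective _≡_ _≡_ f → ∃ λ i → r ≤ f i
  injective⇒large-value {r} f inj with any? (λ i → r ≤? f i)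
  ... | yes p = p
  ... | no ¬p =
    let i , j , i<j , eq = pigeonhole (n<1+n r) (λ i → fromℕ< (f<r i))
    in contradiction (inj (fromℕ<-injective _ _ (f<r i) (f<r j) eq)) (Fin.<⇒≢ i<j)
    where
    f<r : ∀ i → f i < r
    f<r i = ≰⇒> (λ r≤fi → ¬p (i , r≤fi))

  -- This is r (r - 1) / 2 ≤ `sum f` without subtraction or division. Among r + 1 distinct values
  -- one is at least r; removing it leaves r distinct values.
  sum-injective-≥ : ∀ {r} (f : Fin r → ℕ) → Injective _≡_ _≡_ f → r * r ≤ 2 * sum f + r
  sum-injective-≥ {zero}  f inj = z≤n
  sum-injective-≥ {suc r} f inj with injective⇒large-value f inj
  ... | i , r≤fi = begin
    suc r * suc r                           ≡⟨ e₁ r ⟩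
    r * r + (2 * r + 1)                     ≤⟨ +-mono-≤ (sum-injective-≥ g g-inj) (+-monoˡ-≤ 1 (*-monoʳ-≤ 2 r≤fi)) ⟩
    2 * sum g + r + (2 * f i + 1)           ≡⟨ e₂ (sum g) r (f i) ⟩
    2 * (f i + sum g) + suc r               ≡⟨ cong (λ t → 2 * t + suc r) (sum-remove f) ⟨
    2 * sum f + suc r                       ∎
    where
    open ≤-Reasoning
    g = removeAt f i
    g-inj : Injective _≡_ _≡_ g
    g-inj {j} {k} = punchIn-injective i j k ∘ inj
    e₁ : ∀ r → suc r * suc r ≡ r * r + (2 * r + 1)
    e₁ = solve-∀
    e₂ : ∀ s r x → 2 * s + r + (2 * x + 1) ≡ 2 * (x + s) + suc r
    e₂ = solve-∀

  ∑<-split : ∀ m n f → ∑< (m + n) f ≡ ∑< m f + ∑< n (λ j → f (m + j))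
  ∑<-split zero    n f = refl
  ∑<-split (suc m) n f = trans (cong (f 0 +_) (∑<-split m n (f ∘ suc))) (sym (+-assoc (f 0) _ _))

  ∑<-last : ∀ n f → ∑< (suc n) f ≡ ∑< n f + f n
  ∑<-last zero    f = +-identityʳ (f 0)
  ∑<-last (suc n) f = trans (cong (f 0 +_) (∑<-last n (f ∘ suc))) (sym (+-assoc (f 0) _ _))

  WindowInjective : ℕ → (ℕ → ℕ) → Set
  WindowInjective c f = ∀ i j → i < j → j < i + c → f i ≢ f j

  2xy≤x²+y² : ∀ x y → 2 * (x * y) ≤ x * x + y * y
  2xy≤x²+y² x y with ≤-total x y
  ... | inj₁ x≤y = subst (λ y → 2 * (x * y) ≤ x * x + y * y) (m+[n∸m]≡n x≤y)
    (≤-trans (m≤m+n _ (z * z)) (≤-reflexive (e x z)))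
    where
    z = y ∸ x
    e : ∀ x z → 2 * (x * (x + z)) + z * z ≡ x * x + (x + z) * (x + z)
    e = solve-∀
  ... | inj₂ y≤x = subst (λ x → 2 * (x * y) ≤ x * x + y * y) (m+[n∸m]≡n y≤x)
    (≤-trans (m≤m+n _ (z * z)) (≤-reflexive (e y z)))
    where
    z = x ∸ y
    e : ∀ y z → 2 * ((y + z) * y) + z * z ≡ (y + z) * (y + z) + y * y
    e = solve-∀

  window-sum-≥ : ∀ {r c f} → WindowInjective c f → r ≤ c → r * r ≤ 2 * ∑< r f + r
  window-sum-≥ {r} {c} {f} inj r≤c = sum-injective-≥ (f ∘ toℕ) f-inj
    where
    separated : ∀ {i j : Fin r} → toℕ i < toℕ j → f (toℕ i) ≢ f (toℕ j)
    separated {i} {j} i<j =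
      inj (toℕ i) (toℕ j) i<j (≤-trans (toℕ<n j) (≤-trans r≤c (m≤n+m c (toℕ i))))
    f-inj : Injective _≡_ _≡_ (f ∘ toℕ)
    f-inj {i} {j} eq with <-cmp (toℕ i) (toℕ j)
    ... | tri< i<j _ _ = contradiction eq (separated i<j)
    ... | tri≈ _ i≡j _ = toℕ-injective i≡j
    ... | tri> _ _ j<i = contradiction (sym eq) (separated j<i)

  WindowInjective-shift : ∀ {c f} m → WindowInjective c f → WindowInjective c (λ j → f (m + j))
  WindowInjective-shift {c} m inj i j i<j j<i+c =
    inj (m + i) (m + j) (+-monoʳ-< m i<j)
      (subst (m + j <_) (sym (+-assoc m i c)) (+-monoʳ-< m j<i+c))

  ∑<-cong : ∀ n {f g} → (∀ i → i < n → f i ≡ g i) → ∑< n f ≡ ∑< n g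
  ∑<-cong n h = sum-cong-≗ (λ i → h (toℕ i) (toℕ<n i))

  ∑<-const : ∀ n x → ∑< n (λ _ → x) ≡ n * x
  ∑<-const zero    x = refl
  ∑<-const (suc n) x = cong (x +_) (∑<-const n x)

  module _ (c : ℕ) .{{_ : NonZero c}} where

    open ≤-Reasoning

    -- A full window holds c distinct numbers and so already reaches the mean (c - 1) / 2 per term.
    -- Only the last, incomplete window can fall short: with r terms by at most r (c - r) / 2 ≤ c² /
    -- 8.
    ∑-window-≥ : ∀ L f → WindowInjective c f → 4 * (L * c) ≤ 8 * ∑< L f + 4 * L + c * c
    ∑-window-≥ L f = go L f (<-wellFounded L)
      where
      go : ∀ L f → Acc _<_ L → WindowInjective c f → 4 * (L * c) ≤ 8 * ∑< L f + 4 * L + c * c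
      go L f (acc rs) inj with L ≤? c
      ... | yes L≤c = begin
        4 * (L * c)                          ≡⟨ e₁ L c ⟩
        -- The inequality between 2L and c is 4 L (c - L) ≤ c², the source of the error term.
        2 * (2 * L * c)                      ≤⟨ 2xy≤x²+y² (2 * L) c ⟩
        2 * L * (2 * L) + c * c              ≡⟨ e₂ L c ⟩
        4 * (L * L) + c * c                  ≤⟨ +-monoˡ-≤ (c * c) (*-monoʳ-≤ 4 (window-sum-≥ inj L≤c)) ⟩
        4 * (2 * ∑< L f + L) + c * c         ≡⟨ e₃ (∑< L f) L (c * c) ⟩
        8 * ∑< L f + 4 * L + c * c           ∎
        where
        e₁ : ∀ L c → 4 * (L * c) ≡ 2 * (2 * L * c)
        e₁ = solve-∀
        e₂ : ∀ L c → 2 * L * (2 * L) + c * c ≡ 4 * (L * L) + c * c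
        e₂ = solve-∀
        e₃ : ∀ S L q → 4 * (2 * S + L) + q ≡ 8 * S + 4 * L + q
        e₃ = solve-∀
      ... | no L≰c = subst (λ L → 4 * (L * c) ≤ 8 * ∑< L f + 4 * L + c * c) (m+[n∸m]≡n c≤L) (begin
        4 * ((c + r) * c)                                          ≡⟨ e₁ c r ⟩
        4 * (c * c) + 4 * (r * c)                                  ≤⟨ +-mono-≤ (*-monoʳ-≤ 4 (window-sum-≥ inj ≤-refl)) (go r f′ (rs r<L) (WindowInjective-shift c inj)) ⟩
        4 * (2 * ∑< c f + c) + (8 * ∑< r f′ + 4 * r + c * c)       ≡⟨ e₂ (∑< c f) c (∑< r f′) r (c * c) ⟩
        8 * (∑< c f + ∑< r f′) + 4 * (c + r) + c * c               ≡⟨ cong (λ t → 8 * t + 4 * (c + r) + c * c) (∑<-split c r f) ⟨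
        8 * ∑< (c + r) f + 4 * (c + r) + c * c                     ∎)
        where
        c≤L = <⇒≤ (≰⇒> L≰c)
        r = L ∸ c
        f′ = λ j → f (c + j)
        r<L : r < L
        r<L = ∸-monoʳ-< {L} {c} {0} (>-nonZero⁻¹ c) c≤L
        e₁ : ∀ c r → 4 * ((c + r) * c) ≡ 4 * (c * c) + 4 * (r * c)
        e₁ = solve-∀
        e₂ : ∀ x c y r q → 4 * (2 * x + c) + (8 * y + 4 * r + q) ≡ 8 * (x + y) + 4 * (c + r) + q
        e₂ = solve-∀

    -- The lower bound applied to the reflected sequence c - 1 - f.
    ∑-window-≤ : ∀ L f → (∀ i → f i < c) → WindowInjective c f
               → 8 * ∑< L f + 4 * L ≤ 4 * (L * c) + c * c
    ∑-window-≤ L f f<c inj = +-cancelˡ-≤ (4 * (L * c)) _ _ (begin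
      4 * (L * c) + (8 * ∑< L f + 4 * L)                     ≤⟨ +-monoˡ-≤ (8 * ∑< L f + 4 * L) (∑-window-≥ L g g-inj) ⟩
      8 * ∑< L g + 4 * L + c * c + (8 * ∑< L f + 4 * L)      ≡⟨ e₁ (∑< L g) L (c * c) (∑< L f) ⟩
      8 * (L * 1 + ∑< L f + ∑< L g) + c * c                  ≡⟨ cong (λ t → 8 * t + c * c) f+g ⟩
      8 * (L * c) + c * c                                    ≡⟨ e₂ (L * c) (c * c) ⟩
      4 * (L * c) + (4 * (L * c) + c * c)                    ∎)
      where
      g = λ i → c ∸ suc (f i)
      g-inj : WindowInjective c g
      g-inj i j i<j j<i+c eq = inj i j i<j j<i+c (suc-injective (∸-cancelˡ-≡ (f<c i) (f<c j) eq))
      f+g : L * 1 + ∑< L f + ∑< L g ≡ L * c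
      f+g = trans (cong (λ t → t + ∑< L f + ∑< L g) (sym (∑<-const L 1)))
        (trans (cong (_+ ∑< L g) (sym (∑-distrib-+ {L} (λ _ → 1) (f ∘ toℕ))))
        (trans (sym (∑-distrib-+ {L} (suc ∘ f ∘ toℕ) (g ∘ toℕ)))
        (trans (∑<-cong L (λ i _ → m+[n∸m]≡n (f<c i))) (∑<-const L c))))
      e₁ : ∀ x L q y → 8 * x + 4 * L + q + (8 * y + 4 * L) ≡ 8 * (L * 1 + y + x) + q
      e₁ = solve-∀
      e₂ : ∀ x q → 8 * x + q ≡ 4 * x + (4 * x + q)
      e₂ = solve-∀

  -- Counting solutions in two and three variables

  ind : ∀ {p} {P : Set p} → Dec P → ℕ
  ind P? = if does P? then 1 else 0

  ind-cong : ∀ {p q} {P : Set p} {Q : Set q} (P? : Dec P) (Q? : Dec Q) → (P → Q) → (Q → P) → ind P? ≡ ind Q?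
  ind-cong (yes p) (yes q) f g = refl
  ind-cong (yes p) (no ¬q) f g = contradiction (f p) ¬q
  ind-cong (no ¬p) (yes q) f g = contradiction (g q) ¬p
  ind-cong (no ¬p) (no ¬q) f g = refl

  ind-yes : ∀ {p} {P : Set p} (P? : Dec P) → P → ind P? ≡ 1
  ind-yes (yes _) p = refl
  ind-yes (no ¬p) p = contradiction p ¬p

  ind-no : ∀ {p} {P : Set p} (P? : Dec P) → ¬ P → ind P? ≡ 0
  ind-no (yes p) ¬p = contradiction p ¬p
  ind-no (no _)  ¬p = refl

  module _ {A : Set} {P : Pred A 0ℓ} (P? : Decidable P) where

    count-map : ∀ n (h : ℕ → A) g → length (filter P? (map h (applyUpTo g n))) ≡ ∑< n (λ i → ind (P? (h (g i))))
    count-map zero    h g = refl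
    count-map (suc n) h g with P? (h (g 0))
    ... | yes _ = cong suc (count-map n h (g ∘ suc))
    ... | no  _ = count-map n h (g ∘ suc)

    count-concatMap : ∀ n (f : ℕ → List A) g
      → length (filter P? (concatMap f (applyUpTo g n))) ≡ ∑< n (λ i → length (filter P? (f (g i))))
    count-concatMap zero    f g = refl
    count-concatMap (suc n) f g = begin
      length (filter P? (f (g 0) ++ rest))              ≡⟨ cong length (filter-++ P? (f (g 0)) rest) ⟩
      length (filter P? (f (g 0)) ++ filter P? rest)    ≡⟨ length-++ (filter P? (f (g 0))) ⟩
      length (filter P? (f (g 0))) + length (filter P? rest)      ≡⟨ cong (length (filter P? (f (g 0))) +_) (count-concatMap n f (g ∘ suc)) ⟩
      ∑< (suc n) (λ i → length (filter P? (f (g i))))             ∎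
      where
      open ≡-Reasoning
      rest = concatMap f (applyUpTo (g ∘ suc) n)

  -- The cutoffs are separate because the recursion on y shortens only the range of y, while that of
  -- z stays fixed.
  count₂ : (b c H₂ H₃ m : ℕ) → ℕ
  count₂ b c H₂ H₃ m = ∑< H₂ λ y → ∑< H₃ λ z → ind (b * y + c * z ≟ m)

  count₃ : (a b c H₁ H₂ H₃ n : ℕ) → ℕ
  count₃ a b c H₁ H₂ H₃ n = ∑< H₁ λ x → ∑< H₂ λ y → ∑< H₃ λ z → ind (a * x + b * y + c * z ≟ n)

  count-triples : ∀ {P : Pred (ℕ × ℕ × ℕ) 0ℓ} (P? : Decidable P) n → let H = suc n in
    length (filter P? (triples n)) ≡ ∑< H λ x → ∑< H λ y → ∑< H λ z → ind (P? (x , y , z))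
  count-triples P? n =
    trans (count-concatMap P? H (λ x → concatMap (λ y → map (λ z → x , y , z) (upTo H)) (upTo H)) id) (sum-cong-≗ {H} λ x →
      trans (count-concatMap P? H (λ y → map (λ z → toℕ x , y , z) (upTo H)) id) (sum-cong-≗ {H} λ y →
        count-map P? H (λ z → toℕ x , toℕ y , z) id))
    where
    H = suc n

  numSolℕ≡count₃ : ∀ a b c n → numSolℕ a b c n ≡ count₃ a b c (suc n) (suc n) (suc n) n
  -- The pattern lambda agrees with the one inside numSolℕ by η for pairs.
  numSolℕ≡count₃ a b c n = count-triples (λ { (x , y , z) → a * x + b * y + c * z ≟ n }) n

  ∑<-zero : ∀ n {f} → (∀ i → i < n → f i ≡ 0) → ∑< n f ≡ 0
  ∑<-zero n h = trans (∑<-cong n h) (trans (∑<-const n 0) (*-zeroʳ n))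

  ∑-ind-none : ∀ H {P : Pred ℕ 0ℓ} (P? : Decidable P) → (∀ i → ¬ P i) → ∑< H (λ i → ind (P? i)) ≡ 0
  ∑-ind-none H P? ¬P = ∑<-zero H λ i _ → ind-no (P? i) (¬P i)

  ∑-ind-unique : ∀ H {P : Pred ℕ 0ℓ} (P? : Decidable P) w → w < H → P w → (∀ i → P i → i ≡ w) → ∑< H (λ i → ind (P? i)) ≡ 1
  ∑-ind-unique (suc H) P? zero    _   Pw uniq =
    cong₂ _+_ (ind-yes (P? 0) Pw) (∑-ind-none H (P? ∘ suc) λ i Pi → 1+n≢0 (uniq (suc i) Pi))
  ∑-ind-unique (suc H) P? (suc w) w<H Pw uniq =
    cong₂ _+_ (ind-no (P? 0) λ P0 → 0≢1+n (uniq 0 P0))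
      (∑-ind-unique H (P? ∘ suc) w (s≤s⁻¹ w<H) Pw λ i Pi → suc-injective (uniq (suc i) Pi))

  count₂-step : ∀ b c H₂ H₃ m → ∑< H₂ (λ y → ∑< H₃ λ z → ind (b * suc y + c * z ≟ b + m)) ≡ count₂ b c H₂ H₃ m
  count₂-step b c H₂ H₃ m = sum-cong-≗ {H₂} λ y → sum-cong-≗ {H₃} λ z →
    ind-cong (_ ≟ _) (_ ≟ _)
      (λ eq → +-cancelˡ-≡ b _ _ (trans (sym (e b (toℕ y) (c * toℕ z))) eq))
      (λ eq → trans (e b (toℕ y) (c * toℕ z)) (cong (b +_) eq))
    where
    e : ∀ b y w → b * suc y + w ≡ b + (b * y + w)
    e = solve-∀

  module _ {b c : ℕ} .{{_ : NonZero b}} .{{_ : NonZero c}} (c⊥b : Coprime c b) where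

    private
      b≥1 : 1 ≤ b
      b≥1 = >-nonZero⁻¹ b

      m′<H₂ : ∀ {m H} → b ≤ m → m < suc H → m ∸ b < H
      m′<H₂ b≤m m<H = <-≤-trans (∸-monoʳ-< b≥1 b≤m) (s≤s⁻¹ m<H)

      count₁-∣ : ∀ H m w → m < H → m ≡ c * w → ∑< H (λ z → ind (b * 0 + c * z ≟ m)) ≡ 1
      count₁-∣ H m w m<H m≡cw = ∑-ind-unique H (λ z → b * 0 + c * z ≟ m) w
        (≤-<-trans (≤-trans (m≤n*m w c) (≤-reflexive (sym m≡cw))) m<H)
        (trans (cong (_+ c * w) (*-zeroʳ b)) (sym m≡cw))
        λ i eq → *-cancelˡ-≡ i w c (trans (trans (cong (_+ c * i) (sym (*-zeroʳ b))) eq) m≡cw)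

      count₁-∤ : ∀ H m → c ∤ m → ∑< H (λ z → ind (b * 0 + c * z ≟ m)) ≡ 0
      count₁-∤ H m c∤m = ∑-ind-none H (λ z → b * 0 + c * z ≟ m)
        λ z eq → c∤m (divides z (trans (sym eq) (trans (cong (_+ c * z) (*-zeroʳ b)) (*-comm c z))))

      residue-∤ : ∀ m u v T → suc u < c → b * suc u + c * v + b * c * T ≡ m + b * c → c ∤ m
      residue-∤ m u v T u<c eq c∣m = >⇒∤ u<c (coprime-divisor c⊥b
        (∣m+n∣m⇒∣n (subst (c ∣_) (trans (sym eq) (e b (suc u) c v T)) (∣m∣n⇒∣m+n c∣m (n∣m*n b)))
          (m∣m*n {c} (v + b * T))))
        where
        e : ∀ b u c v T → b * u + c * v + b * c * T ≡ c * (v + b * T) + b * u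
        e = solve-∀

      T≢0 : ∀ m v → v < b → b * 0 + c * v + b * c * 0 ≢ m + b * c
      T≢0 m v v<b eq = <⇒≱ (*-monoʳ-< c v<b)
        (≤-trans (m≤n+m (c * b) m) (≤-reflexive (trans (cong (m +_) (*-comm c b)) (trans (sym eq) (e b (c * v) c)))))
        where
        e : ∀ b w c → b * 0 + w + b * c * 0 ≡ w
        e = solve-∀

      T-pred : ∀ m v T → b * 0 + c * v + b * c * suc T ≡ m + b * c → c * v + b * c * T ≡ m
      T-pred m v T eq = +-cancelʳ-≡ (b * c) _ _ (trans (e b (c * v) c T) eq)
        where
        e : ∀ b w c T → w + b * c * T + b * c ≡ b * 0 + w + b * c * suc T
        e = solve-∀

    private
      -- x is the inverse of b modulo c; z avoids negative coefficients.
      invertible : ∃ λ x → ∃₂ λ y z → 1 + y * c ≡ x * b + z * c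
      invertible with coprime-Bézout c⊥b
      ... | Bézout.+- y x eq = x * (c ∸ 1) , b * x , y , (begin
        1 + b * x * c                   ≡⟨ cong (λ t → 1 + b * x * t) (m+[n∸m]≡n {1} {c} (>-nonZero⁻¹ c)) ⟨
        1 + b * x * suc (c ∸ 1)         ≡⟨ e b x (c ∸ 1) ⟩
        x * (c ∸ 1) * b + (1 + x * b)   ≡⟨ cong (x * (c ∸ 1) * b +_) eq ⟩
        x * (c ∸ 1) * b + y * c         ∎)
        where
        open ≡-Reasoning
        e : ∀ b x d → 1 + b * x * suc d ≡ x * d * b + (1 + x * b)
        e = solve-∀
      ... | Bézout.-+ y x eq = x , y , 0 , trans eq (sym (+-identityʳ (x * b)))

    -- Induction on the range of y, passing from m to m - b. The term y = 0 contributes 1 exactly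
    -- when c divides m, which means u = 0. If u is positive, it drops by one and T is unchanged. If
    -- b > m, only y = 0 is possible and the equation leaves T no other value.
    count₂-formula : ∀ H₂ H₃ m u v T → m < H₂ → m < H₃ → u < c → v < b
      → b * u + c * v + b * c * T ≡ m + b * c → count₂ b c H₂ H₃ m ≡ T
    count₂-formula (suc H₂) H₃ m u v T m<H₂ m<H₃ u<c v<b eq with b ≤? m
    -- With u = 0 and T = 0 the equation would read c v = m + b c, although v < b.
    count₂-formula (suc H₂) H₃ m zero v zero m<H₂ m<H₃ u<c v<b eq | _ = contradiction eq (T≢0 m v v<b)
    count₂-formula (suc H₂) H₃ m zero v (suc T) m<H₂ m<H₃ u<c v<b eq | no b≰m =
      trans (cong₂ _+_ (count₁-∣ H₃ m (v + b * T) m<H₃ (trans (sym m≡) (e₁ c v b T))) rest) (cong suc (sym (T≡0 T m≡)))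
      where
      m≡ = T-pred m v T eq
      e₁ : ∀ c v b T → c * v + b * c * T ≡ c * (v + b * T)
      e₁ = solve-∀
      T≡0 : ∀ T → c * v + b * c * T ≡ m → T ≡ 0
      T≡0 zero    _ = refl
      T≡0 (suc T) h = contradiction (≤-trans (≤-trans (m≤m*n b c) (m≤m*n (b * c) (suc T)))
        (≤-trans (m≤n+m (b * c * suc T) (c * v)) (≤-reflexive h))) b≰m
      rest : ∑< H₂ (λ y → ∑< H₃ λ z → ind (b * suc y + c * z ≟ m)) ≡ 0
      rest = ∑<-zero H₂ λ y _ → ∑-ind-none H₃ (λ z → b * suc y + c * z ≟ m)
        λ z h → b≰m (≤-trans (m≤m*n b (suc y)) (≤-trans (m≤m+n _ (c * z)) (≤-reflexive h)))
    count₂-formula (suc H₂) H₃ m (suc u) v T m<H₂ m<H₃ u<c v<b eq | no b≰m =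
      trans (cong₂ _+_ (count₁-∤ H₃ m (residue-∤ m u v T u<c eq)) rest) (sym (T≡0 T eq))
      where
      T≡0 : ∀ T → b * suc u + c * v + b * c * T ≡ m + b * c → T ≡ 0
      T≡0 zero    _ = refl
      T≡0 (suc T) h = contradiction (+-cancelʳ-≤ (b * c) b m
        (≤-trans (m≤m+n (b + b * c) (b * u + c * v + b * c * T)) (≤-reflexive (trans (e b u (c * v) c T) h)))) b≰m
        where
        e : ∀ b u w c T → b + b * c + (b * u + w + b * c * T) ≡ b * suc u + w + b * c * suc T
        e = solve-∀
      rest : ∑< H₂ (λ y → ∑< H₃ λ z → ind (b * suc y + c * z ≟ m)) ≡ 0
      rest = ∑<-zero H₂ λ y _ → ∑-ind-none H₃ (λ z → b * suc y + c * z ≟ m)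
        λ z h → b≰m (≤-trans (m≤m*n b (suc y)) (≤-trans (m≤m+n _ (c * z)) (≤-reflexive h)))
    -- The residue 0 wraps around to c - 1, which adds b c on the left; T falls by one to
    -- compensate, and that one is the solution with y = 0.
    count₂-formula (suc H₂) H₃ m zero v (suc T) m<H₂ m<H₃ u<c v<b eq | yes b≤m =
      cong₂ _+_ (count₁-∣ H₃ m (v + b * T) m<H₃ (trans (sym m≡) (e₁ c v b T)))
        (trans (cong (λ m → ∑< H₂ (λ y → ∑< H₃ λ z → ind (b * suc y + c * z ≟ m))) (sym b+m′))
          (trans (count₂-step b c H₂ H₃ m′)
            (count₂-formula H₂ H₃ m′ (c ∸ 1) v T (m′<H₂ b≤m m<H₂) (≤-<-trans (m∸n≤m m b) m<H₃)
              (∸-monoʳ-< {c} {1} {0} z<s u<c) v<b (+-cancelˡ-≡ b _ _ (begin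
              b + (b * (c ∸ 1) + c * v + b * c * T)   ≡⟨ e₂ b (c ∸ 1) (c * v + b * c * T) (b * (c ∸ 1) + c * v + b * c * T) (+-assoc (b * (c ∸ 1)) _ _) ⟩
              b * suc (c ∸ 1) + (c * v + b * c * T)   ≡⟨ cong₂ (λ c w → b * c + w) (m+[n∸m]≡n {1} {c} u<c) (trans m≡ (sym b+m′)) ⟩
              b * c + (b + m′)                        ≡⟨ e₃ (b * c) b m′ ⟩
              b + (m′ + b * c)                        ∎)))))
      where
      open ≡-Reasoning
      m′ = m ∸ b
      b+m′ = m+[n∸m]≡n b≤m
      m≡ = T-pred m v T eq
      e₁ : ∀ c v b T → c * v + b * c * T ≡ c * (v + b * T)
      e₁ = solve-∀
      e₂ : ∀ b d w x → x ≡ b * d + w → b + x ≡ b * suc d + w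
      e₂ b d w .(b * d + w) refl = trans (sym (+-assoc b (b * d) w)) (cong (_+ w) (sym (*-suc b d)))
      e₃ : ∀ q b m → q + (b + m) ≡ b + (m + q)
      e₃ = solve-∀
    count₂-formula (suc H₂) H₃ m (suc u) v T m<H₂ m<H₃ u<c v<b eq | yes b≤m =
      cong₂ _+_ (count₁-∤ H₃ m (residue-∤ m u v T u<c eq))
        (trans (cong (λ m → ∑< H₂ (λ y → ∑< H₃ λ z → ind (b * suc y + c * z ≟ m))) (sym b+m′))
          (trans (count₂-step b c H₂ H₃ m′)
            (count₂-formula H₂ H₃ m′ u v T (m′<H₂ b≤m m<H₂) (≤-<-trans (m∸n≤m m b) m<H₃)
              (<-trans (n<1+n u) u<c) v<b (+-cancelˡ-≡ b _ _
                (trans (e b u (c * v) (b * c * T)) (trans eq (trans (cong (_+ b * c) (sym b+m′)) (+-assoc b m′ (b * c)))))))))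
      where
      m′ = m ∸ b
      b+m′ = m+[n∸m]≡n b≤m
      e : ∀ b u w x → b + (b * u + w + x) ≡ b * suc u + w + x
      e = solve-∀

    -- With u the residue of m / b modulo c, the number w = m + b c - b u is divisible by c, and
    -- dividing w / c by b with remainder yields T and v. The summand b c keeps w nonnegative, as u
    -- < c.
    residues : ∀ m → ∃ λ u → ∃₂ λ v T → u < c × v < b × b * u + c * v + b * c * T ≡ m + b * c
    residues m = u , w / c % b , w / c / b , m%n<n _ c , m%n<n _ b , (begin
      b * u + c * (w / c % b) + b * c * (w / c / b)     ≡⟨ e₁ b u c (w / c % b) (w / c / b) ⟩
      b * u + (w / c % b + w / c / b * b) * c           ≡⟨ cong (λ t → b * u + t * c) (m≡m%n+[m/n]*n (w / c) b) ⟨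
      b * u + w / c * c                                 ≡⟨ cong (b * u +_) (m/n*n≡m c∣w) ⟩
      b * u + w                                         ≡⟨ m+[n∸m]≡n bu≤m+bc ⟩
      m + b * c                                         ∎)
      where
      open ≡-Reasoning
      inv = invertible
      x = proj₁ inv
      y = proj₁ (proj₂ inv)
      z = proj₁ (proj₂ (proj₂ inv))
      u = m * x % c
      q = m * x / c
      bu≤m+bc : b * u ≤ m + b * c
      bu≤m+bc = ≤-trans (*-monoʳ-≤ b (<⇒≤ (m%n<n (m * x) c))) (m≤n+m (b * c) m)
      w = m + b * c ∸ b * u
      -- This is m times the relation defining the inverse x, with m x split into q c + u; both
      -- sides but for w are multiples of c.
      w+myc : (b + b * q + m * z) * c ≡ m * y * c + w
      w+myc = +-cancelˡ-≡ (m + b * u) _ _ (begin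
        m + b * u + (b + b * q + m * z) * c             ≡⟨ e₂ m b u q z c ⟩
        m + b * c + (b * (u + q * c) + m * z * c)       ≡⟨ cong (λ t → m + b * c + (b * t + m * z * c)) (m≡m%n+[m/n]*n (m * x) c) ⟨
        m + b * c + (b * (m * x) + m * z * c)           ≡⟨ cong₂ _+_ (sym (m+[n∸m]≡n bu≤m+bc)) (e₃ b m x z c) ⟩
        b * u + w + m * (x * b + z * c)                 ≡⟨ cong (λ t → b * u + w + m * t) (proj₂ (proj₂ (proj₂ inv))) ⟨
        b * u + w + m * (1 + y * c)                     ≡⟨ e₄ (b * u) w m y c ⟩
        m + b * u + (m * y * c + w)                     ∎)
        where
        e₂ : ∀ m b u q z c → m + b * u + (b + b * q + m * z) * c ≡ m + b * c + (b * (u + q * c) + m * z * c)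
        e₂ = solve-∀
        e₃ : ∀ b m x z c → b * (m * x) + m * z * c ≡ m * (x * b + z * c)
        e₃ = solve-∀
        e₄ : ∀ p w m y c → p + w + m * (1 + y * c) ≡ m + p + (m * y * c + w)
        e₄ = solve-∀
      c∣w : c ∣ w
      c∣w = ∣m+n∣m⇒∣n (subst (c ∣_) w+myc (n∣m*n (b + b * q + m * z))) (n∣m*n (m * y))
      e₁ : ∀ b u c v T → b * u + c * v + b * c * T ≡ b * u + (v + T * b) * c
      e₁ = solve-∀

  module _ {a b c H₂ H₃ : ℕ} where

    count₃-head : ∀ n → ∑< H₂ (λ y → ∑< H₃ λ z → ind (a * 0 + b * y + c * z ≟ n)) ≡ count₂ b c H₂ H₃ n
    count₃-head n = cong (λ t → ∑< H₂ (λ y → ∑< H₃ λ z → ind (t + b * y + c * z ≟ n))) (*-zeroʳ a)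

    count₃-step : ∀ H₁ n → ∑< H₁ (λ x → ∑< H₂ λ y → ∑< H₃ λ z → ind (a * suc x + b * y + c * z ≟ a + n))
      ≡ count₃ a b c H₁ H₂ H₃ n
    count₃-step H₁ n = sum-cong-≗ {H₁} λ x → sum-cong-≗ {H₂} λ y → sum-cong-≗ {H₃} λ z →
      let shift = e a (toℕ x) (b * toℕ y) (c * toℕ z) in
      ind-cong (_ ≟ _) (_ ≟ _)
        (λ eq → +-cancelˡ-≡ a _ _ (trans (sym shift) eq))
        (λ eq → trans shift (cong (a +_) eq))
      where
      e : ∀ a x v w → a * suc x + v + w ≡ a + (a * x + v + w)
      e = solve-∀

    -- A fixed x leaves the equation b y + c z = n - a x, so j stands for q - x. Splitting off x = 0
    -- therefore removes the last term of the sum over j.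
    count₃-reduce : ∀ q s H₁ → s < a → q < H₁
      → count₃ a b c H₁ H₂ H₃ (s + a * q) ≡ ∑< (suc q) (λ j → count₂ b c H₂ H₃ (s + a * j))
    count₃-reduce zero s (suc H₁) s<a _ = cong₂ _+_ (count₃-head (s + a * 0))
      (∑<-zero H₁ λ x _ → ∑<-zero H₂ λ y _ → ∑-ind-none H₃ (λ z → a * suc x + b * y + c * z ≟ s + a * 0) λ z eq →
        <⇒≱ s<a (begin
          a                           ≤⟨ m≤m*n a (suc x) ⟩
          a * suc x                   ≤⟨ m≤m+n (a * suc x) (b * y + c * z) ⟩
          a * suc x + (b * y + c * z) ≡⟨ +-assoc (a * suc x) (b * y) (c * z) ⟨
          a * suc x + b * y + c * z   ≡⟨ eq ⟩
          s + a * 0                   ≡⟨ cong (s +_) (*-zeroʳ a) ⟩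
          s + 0                       ≡⟨ +-identityʳ s ⟩
          s                           ∎))
      where open ≤-Reasoning
    count₃-reduce (suc q) s (suc H₁) s<a q<H₁ = begin
      count₃ a b c (suc H₁) H₂ H₃ n                        ≡⟨ cong₂ _+_ (count₃-head n) tail ⟩
      count₂ b c H₂ H₃ n + ∑< (suc q) f                    ≡⟨ +-comm (count₂ b c H₂ H₃ n) _ ⟩
      ∑< (suc q) f + f (suc q)                             ≡⟨ ∑<-last (suc q) f ⟨
      ∑< (suc (suc q)) f                                   ∎
      where
      open ≡-Reasoning
      n = s + a * suc q
      f = λ j → count₂ b c H₂ H₃ (s + a * j)
      e : ∀ s a q → s + a * suc q ≡ a + (s + a * q)
      e = solve-∀
      tail : ∑< H₁ (λ x → ∑< H₂ λ y → ∑< H₃ λ z → ind (a * suc x + b * y + c * z ≟ n)) ≡ ∑< (suc q) f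
      tail = trans (cong (λ t → ∑< H₁ (λ x → ∑< H₂ λ y → ∑< H₃ λ z → ind (a * suc x + b * y + c * z ≟ t))) (e s a q))
        (trans (count₃-step H₁ (s + a * q)) (count₃-reduce q s H₁ s<a (s≤s⁻¹ q<H₁)))

  ∑<-affine : ∀ L s a → 2 * ∑< L (λ j → s + a * j) + a * L ≡ L * (2 * s + a * L)
  ∑<-affine zero    s a = *-zeroʳ a
  ∑<-affine (suc L) s a = begin
    2 * ∑< (suc L) f + a * suc L               ≡⟨ cong (λ t → 2 * t + a * suc L) (∑<-last L f) ⟩
    2 * (∑< L f + (s + a * L)) + a * suc L     ≡⟨ e₁ (∑< L f) s a L ⟩
    2 * ∑< L f + a * L + (2 * s + 2 * (a * L) + a)  ≡⟨ cong (_+ (2 * s + 2 * (a * L) + a)) (∑<-affine L s a) ⟩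
    L * (2 * s + a * L) + (2 * s + 2 * (a * L) + a) ≡⟨ e₂ L s a ⟩
    suc L * (2 * s + a * suc L)                ∎
    where
    open ≡-Reasoning
    f = λ j → s + a * j
    e₁ : ∀ S s a L → 2 * (S + (s + a * L)) + a * suc L ≡ 2 * S + a * L + (2 * s + 2 * (a * L) + a)
    e₁ = solve-∀
    e₂ : ∀ L s a → L * (2 * s + a * L) + (2 * s + 2 * (a * L) + a) ≡ suc L * (2 * s + a * suc L)
    e₂ = solve-∀

  -- f j is the residue of (s + a j) / b modulo c; g and r only record multiples of c.
  residue-window : ∀ {a b c} (f g : ℕ → ℕ) s r → Coprime c a
    → (∀ j → b * f j + c * g j ≡ s + a * j + c * r) → WindowInjective c f
  residue-window {a} {b} {c} f g s r c⊥a eq i j i<j j<i+c fi≡fj = >⇒∤ d<c (coprime-divisor c⊥a c∣ad)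
    where
    d = j ∸ i
    i+d = m+[n∸m]≡n (<⇒≤ i<j)
    instance
      d≢0 : NonZero d
      d≢0 = >-nonZero (m<n⇒0<n∸m i<j)
    d<c : d < c
    d<c = +-cancelˡ-< i d c (subst (_< i + c) (sym i+d) j<i+c)
    key : c * g j ≡ c * g i + a * d
    key = +-cancelˡ-≡ (b * f j) _ _ (begin
      b * f j + c * g j                  ≡⟨ eq j ⟩
      s + a * j + c * r                  ≡⟨ cong (λ t → s + a * t + c * r) i+d ⟨
      s + a * (i + d) + c * r            ≡⟨ e₁ s a i d (c * r) ⟩
      s + a * i + c * r + a * d          ≡⟨ cong (_+ a * d) (eq i) ⟨
      b * f i + c * g i + a * d          ≡⟨ cong (λ t → b * t + c * g i + a * d) fi≡fj ⟩
      b * f j + c * g i + a * d          ≡⟨ +-assoc (b * f j) (c * g i) (a * d) ⟩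
      b * f j + (c * g i + a * d)        ∎)
      where
      open ≡-Reasoning
      e₁ : ∀ s a i d x → s + a * (i + d) + x ≡ s + a * i + x + a * d
      e₁ = solve-∀
    c∣ad : c ∣ a * d
    c∣ad = ∣m+n∣m⇒∣n (subst (c ∣_) key (m∣m*n (g j))) (m∣m*n (g i))

  -- The estimate for the number of solutions

  -- Applied with e = a - s, p = b c, t = b + c. Bounding all of 4 e t by multiples of a p t would
  -- give 5 a p t in total, one too many. So three copies use e ≤ a p, and the fourth uses t ≤ 2 p,
  -- which leaves 4 e s + 2 e p to be covered by 4 a² p.
  error-bound : ∀ s e p t → 1 ≤ e → 1 ≤ p → t ≤ 2 * p →
    4 * (e * (s + t)) + (s + e) * p * t < 4 * ((s + e) * p * (s + e + t))
  error-bound s (suc e) (suc p) t _ _ t≤2p = begin-strict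
    4 * (suc e * (s + t)) + a * suc p * t
      ≡⟨ e₁ s e t (a * suc p * t) ⟩
    4 * (suc e * s) + suc e * t + (3 * (suc e * t) + a * suc p * t)
      ≤⟨ +-mono-≤ (+-monoʳ-≤ (4 * (suc e * s)) (*-monoʳ-≤ (suc e) t≤2p))
           (+-monoˡ-≤ (a * suc p * t) (*-monoʳ-≤ 3 (*-monoˡ-≤ t e≤ap))) ⟩
    4 * (suc e * s) + suc e * (2 * suc p) + (3 * (a * suc p * t) + a * suc p * t)
      <⟨ +-monoˡ-< (3 * (a * suc p * t) + a * suc p * t) (m+n≤o⇒m≤o (suc (4 * (suc e * s) + suc e * (2 * suc p))) (≤-reflexive (e₂ s e p))) ⟩
    4 * (a * suc p * a) + (3 * (a * suc p * t) + a * suc p * t)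
      ≡⟨ e₃ (a * suc p) a t ⟩
    4 * (a * suc p * (a + t)) ∎
    where
    open ≤-Reasoning
    a = s + suc e
    e≤ap : suc e ≤ a * suc p
    e≤ap = ≤-trans (m≤n+m (suc e) s) (m≤m*n a (suc p))
    e₁ : ∀ s e t x → 4 * (suc e * (s + t)) + x ≡ 4 * (suc e * s) + suc e * t + (3 * (suc e * t) + x)
    e₁ = solve-∀
    -- Once e and p are written as successors, the difference of the two sides has only nonnegative
    -- coefficients, with a constant term to spare for strictness.
    e₂ : ∀ s e p → suc (4 * (suc e * s) + suc e * (2 * suc p))
      + (p * (4 * (s * s) + 2 + 6 * e + 4 * (e * e) + 8 * s + 8 * (s * e))
        + (1 + 4 * (s * s) + 6 * e + 4 * (e * e) + 4 * s + 4 * (s * e)))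
      ≡ 4 * ((s + suc e) * suc p * (s + suc e))
    e₂ = solve-∀
    e₃ : ∀ x a t → 4 * (x * a) + (3 * (x * t) + x * t) ≡ 4 * (x * (a + t))
    e₃ = solve-∀

  module _ {a b c : ℕ} .{{_ : NonZero a}} .{{_ : NonZero b}} .{{_ : NonZero c}}
    (c⊥b : Coprime c b) (c⊥a : Coprime c a) (b⊥a : Coprime b a) (n : ℕ) where

    private
      N = numSolℕ a b c n
      q = n / a
      s = n % a
      L = suc q
      n≡ : n ≡ s + a * q
      n≡ = trans (m≡m%n+[m/n]*n n a) (cong (s +_) (*-comm q a))
      m : ℕ → ℕ
      m j = s + a * j
      res = λ j → residues c⊥b (m j)
      u = λ j → proj₁ (res j)
      v = λ j → proj₁ (proj₂ (res j))
      T = λ j → proj₁ (proj₂ (proj₂ (res j)))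
      u<c = λ j → proj₁ (proj₂ (proj₂ (proj₂ (res j))))
      v<b = λ j → proj₁ (proj₂ (proj₂ (proj₂ (proj₂ (res j)))))
      uvT : ∀ j → b * u j + c * v j + b * c * T j ≡ m j + b * c
      uvT = λ j → proj₂ (proj₂ (proj₂ (proj₂ (proj₂ (res j)))))
      U = ∑< L u
      V = ∑< L v

      N≡∑T : N ≡ ∑< L T
      N≡∑T = begin
        N                                              ≡⟨ numSolℕ≡count₃ a b c n ⟩
        count₃ a b c (suc n) (suc n) (suc n) n         ≡⟨ cong (count₃ a b c (suc n) (suc n) (suc n)) n≡ ⟩
        count₃ a b c (suc n) (suc n) (suc n) (m q)     ≡⟨ count₃-reduce {a} {b} {c} {suc n} {suc n} q s (suc n) (m%n<n n a) q<1+n ⟩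
        ∑< L (λ j → count₂ b c (suc n) (suc n) (m j))  ≡⟨ ∑<-cong L (λ j j<L → count₂-formula c⊥b (suc n) (suc n) (m j) (u j) (v j) (T j)
                                                            (m<1+n j<L) (m<1+n j<L) (u<c j) (v<b j) (uvT j)) ⟩
        ∑< L T                                         ∎
        where
        open ≡-Reasoning
        q<1+n : q < suc n
        q<1+n = s≤s (≤-trans (m≤n*m q a) (≤-trans (m≤n+m (a * q) s) (≤-reflexive (sym n≡))))
        m<1+n : ∀ {j} → j < L → m j < suc n
        m<1+n j<L = s≤s (≤-trans (+-monoʳ-≤ s (*-monoʳ-≤ a (s≤s⁻¹ j<L))) (≤-reflexive (sym n≡)))

      ∑-linear : b * U + c * V + b * c * N ≡ ∑< L m + L * (b * c)
      ∑-linear = begin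
        b * U + c * V + b * c * N
          ≡⟨ cong₂ _+_ (cong₂ _+_ (*-distribˡ-sum {L} b (u ∘ toℕ)) (*-distribˡ-sum {L} c (v ∘ toℕ)))
               (trans (cong (b * c *_) N≡∑T) (*-distribˡ-sum {L} (b * c) (T ∘ toℕ))) ⟩
        ∑< L (λ j → b * u j) + ∑< L (λ j → c * v j) + ∑< L (λ j → b * c * T j)
          ≡⟨ cong (_+ ∑< L (λ j → b * c * T j)) (∑-distrib-+ {L} (λ i → b * u (toℕ i)) (λ i → c * v (toℕ i))) ⟨
        ∑< L (λ j → b * u j + c * v j) + ∑< L (λ j → b * c * T j)
          ≡⟨ ∑-distrib-+ {L} (λ i → b * u (toℕ i) + c * v (toℕ i)) (λ i → b * c * T (toℕ i)) ⟨
        ∑< L (λ j → b * u j + c * v j + b * c * T j)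
          ≡⟨ ∑<-cong L (λ j _ → uvT j) ⟩
        ∑< L (λ j → m j + b * c)
          ≡⟨ ∑-distrib-+ {L} (m ∘ toℕ) (λ _ → b * c) ⟩
        ∑< L m + ∑< L (λ _ → b * c)
          ≡⟨ cong (∑< L m +_) (∑<-const L (b * c)) ⟩
        ∑< L m + L * (b * c) ∎
        where open ≡-Reasoning

      u-inj : WindowInjective c u
      u-inj = residue-window {b = b} u (λ j → v j + b * T j) s b c⊥a
        λ j → trans (e b (u j) c (v j) (T j)) (trans (uvT j) (cong (m j +_) (*-comm b c)))
        where
        e : ∀ b u c v T → b * u + c * (v + b * T) ≡ b * u + c * v + b * c * T
        e = solve-∀

      v-inj : WindowInjective b v
      v-inj = residue-window {b = c} v (λ j → u j + c * T j) s c b⊥a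
        λ j → trans (e b (u j) c (v j) (T j)) (uvT j)
        where
        e : ∀ b u c v T → c * v + b * (u + c * T) ≡ b * u + c * v + b * c * T
        e = solve-∀

      main : ℕ
      main = L * (n + s + b + c)

      -- 8 times the linear identity, with 8U and 8V compared to their means 4L(c-1) and 4L(b-1).
      identity : 8 * (b * c * N) + (b * (8 * U + 4 * L) + c * (8 * V + 4 * L))
        ≡ 4 * main + (b * (4 * (L * c)) + c * (4 * (L * b)))
      identity = +-cancelʳ-≡ (4 * (a * L)) _ _ (begin
        8 * (b * c * N) + (b * (8 * U + 4 * L) + c * (8 * V + 4 * L)) + 4 * (a * L)
          ≡⟨ e₁ (b * c * N) b c U V L (a * L) ⟩
        8 * (b * U + c * V + b * c * N) + 4 * (L * (b + c)) + 4 * (a * L)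
          ≡⟨ cong (λ t → 8 * t + 4 * (L * (b + c)) + 4 * (a * L)) ∑-linear ⟩
        8 * (∑< L m + L * (b * c)) + 4 * (L * (b + c)) + 4 * (a * L)
          ≡⟨ e₂ (∑< L m) L b c (a * L) ⟩
        4 * (2 * ∑< L m + a * L) + 8 * (L * (b * c)) + 4 * (L * (b + c))
          ≡⟨ cong (λ t → 4 * t + 8 * (L * (b * c)) + 4 * (L * (b + c))) (∑<-affine L s a) ⟩
        4 * (L * (2 * s + a * L)) + 8 * (L * (b * c)) + 4 * (L * (b + c))
          ≡⟨ e₃ q s a b c ⟩
        4 * (L * (s + a * q + s + b + c)) + (b * (4 * (L * c)) + c * (4 * (L * b))) + 4 * (a * L)
          ≡⟨ cong (λ t → 4 * (L * (t + s + b + c)) + (b * (4 * (L * c)) + c * (4 * (L * b))) + 4 * (a * L)) n≡ ⟨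
        4 * main + (b * (4 * (L * c)) + c * (4 * (L * b))) + 4 * (a * L) ∎)
        where
        open ≡-Reasoning
        e₁ : ∀ x b c U V L y → 8 * x + (b * (8 * U + 4 * L) + c * (8 * V + 4 * L)) + 4 * y
          ≡ 8 * (b * U + c * V + x) + 4 * (L * (b + c)) + 4 * y
        e₁ = solve-∀
        e₂ : ∀ M L b c y → 8 * (M + L * (b * c)) + 4 * (L * (b + c)) + 4 * y
          ≡ 4 * (2 * M + y) + 8 * (L * (b * c)) + 4 * (L * (b + c))
        e₂ = solve-∀
        e₃ : ∀ q s a b c → 4 * (suc q * (2 * s + a * suc q)) + 8 * (suc q * (b * c)) + 4 * (suc q * (b + c))
          ≡ 4 * (suc q * (s + a * q + s + b + c)) + (b * (4 * (suc q * c)) + c * (4 * (suc q * b))) + 4 * (a * suc q)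
        e₃ = solve-∀

      err : ℕ
      err = b * (c * c) + c * (b * b)

      -- N shares its side of `identity` with U and V, so bounding it from below takes the upper
      -- bounds for U and V.
      lower : 4 * main ≤ 8 * (b * c * N) + err
      lower = +-cancelʳ-≤ (b * (4 * (L * c)) + c * (4 * (L * b))) _ _ (begin
        4 * main + (b * (4 * (L * c)) + c * (4 * (L * b)))             ≡⟨ identity ⟨
        8 * (b * c * N) + (b * (8 * U + 4 * L) + c * (8 * V + 4 * L))  ≤⟨ +-monoʳ-≤ (8 * (b * c * N))
          (+-mono-≤ (*-monoʳ-≤ b (∑-window-≤ c L u u<c u-inj)) (*-monoʳ-≤ c (∑-window-≤ b L v v<b v-inj))) ⟩
        8 * (b * c * N) + (b * (4 * (L * c) + c * c) + c * (4 * (L * b) + b * b)) ≡⟨ e (8 * (b * c * N)) b c (4 * (L * c)) (c * c) (4 * (L * b)) (b * b) ⟩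
        8 * (b * c * N) + err + (b * (4 * (L * c)) + c * (4 * (L * b))) ∎)
        where
        open ≤-Reasoning
        e : ∀ x b c p q r t → x + (b * (p + q) + c * (r + t)) ≡ x + (b * q + c * t) + (b * p + c * r)
        e = solve-∀

      upper : 8 * (b * c * N) ≤ 4 * main + err
      upper = +-cancelʳ-≤ (b * (8 * U + 4 * L) + c * (8 * V + 4 * L)) _ _ (begin
        8 * (b * c * N) + (b * (8 * U + 4 * L) + c * (8 * V + 4 * L))  ≡⟨ identity ⟩
        4 * main + (b * (4 * (L * c)) + c * (4 * (L * b)))             ≤⟨ +-monoʳ-≤ (4 * main)
          (+-mono-≤ (*-monoʳ-≤ b (∑-window-≥ c L u u-inj)) (*-monoʳ-≤ c (∑-window-≥ b L v v-inj))) ⟩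
        4 * main + (b * (8 * U + 4 * L + c * c) + c * (8 * V + 4 * L + b * b)) ≡⟨ e (4 * main) b c (8 * U + 4 * L) (c * c) (8 * V + 4 * L) (b * b) ⟩
        4 * main + err + (b * (8 * U + 4 * L) + c * (8 * V + 4 * L)) ∎)
        where
        open ≤-Reasoning
        e : ∀ x b c p q r t → x + (b * (p + q) + c * (r + t)) ≡ x + (b * q + c * t) + (b * p + c * r)
        e = solve-∀

      e = a ∸ s
      s+e : s + e ≡ a
      s+e = m+[n∸m]≡n (<⇒≤ (m%n<n n a))
      t = b + c
      P = a * (b * c)

      -- Here e raises n to the next multiple of a: a L = n + e. The product (n + e)(n + s + t) is
      -- then expanded with s + e = a.
      a*main : a * main ≡ n * (n + (a + t)) + e * (s + t)
      a*main = begin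
        a * (L * (n + s + b + c))              ≡⟨ e₁ a q n s b c ⟩
        (a + a * q) * (n + s + t)              ≡⟨ cong (λ z → (z + a * q) * (n + s + t)) s+e ⟨
        (s + e + a * q) * (n + s + t)          ≡⟨ cong (_* (n + s + t)) (trans (e₂ s e (a * q)) (cong (_+ e) (sym n≡))) ⟩
        (n + e) * (n + s + t)                  ≡⟨ e₃ n e s t ⟩
        n * (n + (s + e + t)) + e * (s + t)    ≡⟨ cong (λ z → n * (n + (z + t)) + e * (s + t)) s+e ⟩
        n * (n + (a + t)) + e * (s + t)        ∎
        where
        open ≡-Reasoning
        e₁ : ∀ a q n s b c → a * (suc q * (n + s + b + c)) ≡ (a + a * q) * (n + s + (b + c))
        e₁ = solve-∀
        e₂ : ∀ s e x → s + e + x ≡ s + x + e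
        e₂ = solve-∀
        e₃ : ∀ n e s t → (n + e) * (n + s + t) ≡ n * (n + (s + e + t)) + e * (s + t)
        e₃ = solve-∀

      a*err : a * err ≡ P * t
      a*err = e₁ a b c
        where
        e₁ : ∀ a b c → a * (b * (c * c) + c * (b * b)) ≡ a * (b * c) * (b + c)
        e₁ = solve-∀

    -- Since 2abc = β, this is n (n + 2α) / β - α ≤ N(n). Dropping e (s + t) costs nothing, and the
    -- error abc (b + c) / 4 is well within αβ.
    numSolℕ-lower : n * (n + (a + (b + c)))
      ≤ 2 * (a * (b * c) * numSolℕ a b c n) + a * (b * c) * (a + (b + c))
    numSolℕ-lower = *-cancelˡ-≤ 4 (begin
      4 * (n * (n + (a + t)))                   ≤⟨ *-monoʳ-≤ 4 (m≤m+n (n * (n + (a + t))) (e * (s + t))) ⟩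
      4 * (n * (n + (a + t)) + e * (s + t))     ≡⟨ cong (4 *_) a*main ⟨
      4 * (a * main)                            ≡⟨ e₁ a main ⟩
      a * (4 * main)                            ≤⟨ *-monoʳ-≤ a lower ⟩
      a * (8 * (b * c * N) + err)               ≡⟨ e₂ a (b * c) N err ⟩
      8 * (P * N) + a * err                     ≡⟨ cong (8 * (P * N) +_) a*err ⟩
      8 * (P * N) + P * t                       ≤⟨ +-monoʳ-≤ (8 * (P * N)) (≤-trans (*-monoʳ-≤ P (m≤n+m t a)) (m≤n*m _ 4)) ⟩
      8 * (P * N) + 4 * (P * (a + t))           ≡⟨ e₃ (P * N) (P * (a + t)) ⟩
      4 * (2 * (P * N) + P * (a + t))           ∎)
      where
      open ≤-Reasoning
      e₁ : ∀ a x → 4 * (a * x) ≡ a * (4 * x)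
      e₁ = solve-∀
      e₂ : ∀ a d N x → a * (8 * (d * N) + x) ≡ 8 * (a * d * N) + a * x
      e₂ = solve-∀
      e₃ : ∀ x y → 8 * x + 4 * y ≡ 4 * (2 * x + y)
      e₃ = solve-∀

    -- This is N(n) < n (n + 2α) / β + α. Now e (s + t) counts against the estimate, and
    -- `error-bound` fits it together with the window error into αβ.
    numSolℕ-upper : 2 * (a * (b * c) * numSolℕ a b c n)
      < n * (n + (a + (b + c))) + a * (b * c) * (a + (b + c))
    numSolℕ-upper = *-cancelˡ-< 4 _ _ (begin-strict
      4 * (2 * (P * N))                                        ≡⟨ e₁ a (b * c) N ⟩
      a * (8 * (b * c * N))                                    ≤⟨ *-monoʳ-≤ a upper ⟩
      a * (4 * main + err)                                     ≡⟨ e₂ a main err ⟩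
      4 * (a * main) + a * err                                 ≡⟨ cong₂ (λ x y → 4 * x + y) a*main a*err ⟩
      4 * (n * (n + (a + t)) + e * (s + t)) + P * t            ≡⟨ e₃ (n * (n + (a + t))) (e * (s + t)) (P * t) ⟩
      4 * (n * (n + (a + t))) + (4 * (e * (s + t)) + P * t)    <⟨ +-monoʳ-< (4 * (n * (n + (a + t)))) bound ⟩
      4 * (n * (n + (a + t))) + 4 * (P * (a + t))              ≡⟨ *-distribˡ-+ 4 (n * (n + (a + t))) (P * (a + t)) ⟨
      4 * (n * (n + (a + t)) + P * (a + t))                    ∎)
      where
      open ≤-Reasoning
      bound : 4 * (e * (s + t)) + P * t < 4 * (P * (a + t))
      bound = subst (λ a → 4 * (e * (s + t)) + a * (b * c) * t < 4 * (a * (b * c) * (a + t))) s+e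
        (error-bound s e (b * c) t (m<n⇒0<n∸m (m%n<n n a)) (*-mono-≤ (>-nonZero⁻¹ b) (>-nonZero⁻¹ c))
          (≤-trans (+-mono-≤ (m≤m*n b c) (m≤n*m c b)) (≤-reflexive (e₄ (b * c)))))
        where
        e₄ : ∀ x → x + x ≡ 2 * x
        e₄ = solve-∀
      e₁ : ∀ a d N → 4 * (2 * (a * d * N)) ≡ a * (8 * (d * N))
      e₁ = solve-∀
      e₂ : ∀ a x y → a * (4 * x + y) ≡ 4 * (a * x) + a * y
      e₂ = solve-∀
      e₃ : ∀ x y z → 4 * (x + y) + z ≡ 4 * x + (4 * y + z)
      e₃ = solve-∀

open import Defs
open import Data.Nat as ℕ using (ℕ; suc; NonZero)
open import Data.Nat.GCD using (gcd)
open import Data.Integer using (ℤ; +_; _≥_)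
open import Data.Product using (_×_; _,_)
open import Relation.Binary.PropositionalEquality using (_≡_; _≢_; refl; sym; trans; cong; cong₂; subst; subst₂; module ≡-Reasoning)
open import Relation.Nullary using (¬_; contradiction)
open import Function.Bundles using (_⇔_; mk⇔)

open Counting using (numSolℕ-lower; numSolℕ-upper)
open import Data.Empty using (⊥)
open import Data.Integer as ℤ using (-[1+_]; 0ℤ; _≤_; _<_; _+_; _*_; _-_; +<+; +≤+)
open import Data.Integer.DivMod using (n<s[n/ℕd]*d; div-pos-is-/ℕ)
import Data.Integer.Properties as ℤ
open import Data.Integer.Tactic.RingSolver using (solve-∀)
open import Data.Nat.Coprimality as Coprime using (Coprime; gcd≡1⇒coprime)
import Data.Nat.Properties as ℕ
open import Data.Nat.Tactic.RingSolver using () renaming (solve-∀ to ℕ-solve-∀)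
open import Data.Rational as ℚ using (ℚ; toℚᵘ; ½; 0ℚ; 1ℚ; floor; ↥_; ↧_)
import Data.Rational.Properties as ℚ
open import Data.Rational.Solver using (module +-*-Solver)
import Data.Rational.Unnormalised as ℚᵘ
import Data.Rational.Unnormalised.Properties as ℚᵘ
open import Data.Sum using (_⊎_; inj₁; inj₂)

-- Clearing denominators

private
  ι = ℤ→ℚ

toℚᵘ-/ : ∀ i d .{{_ : NonZero d}} → toℚᵘ (i ℚ./ d) ℚᵘ.≃ i ℚᵘ./ d
toℚᵘ-/ i (suc d) = ℚ.toℚᵘ-fromℚᵘ (ℚᵘ.mkℚᵘ i d)

ι-homo-+ : ∀ i j → ι (i + j) ≡ ι i ℚ.+ ι j
ι-homo-+ i j = ℚ.toℚᵘ-injective (begin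
  toℚᵘ (ι (i + j))                  ≈⟨ toℚᵘ-/ (i + j) 1 ⟩
  (i + j) ℚᵘ./ 1                    ≈⟨ ℚᵘ.*≡* (e i j) ⟩
  i ℚᵘ./ 1 ℚᵘ.+ j ℚᵘ./ 1            ≈⟨ ℚᵘ.+-cong (toℚᵘ-/ i 1) (toℚᵘ-/ j 1) ⟨
  toℚᵘ (ι i) ℚᵘ.+ toℚᵘ (ι j)        ≈⟨ ℚ.toℚᵘ-homo-+ (ι i) (ι j) ⟨
  toℚᵘ (ι i ℚ.+ ι j)                ∎)
  where
  open import Relation.Binary.Reasoning.Setoid ℚᵘ.≃-setoid
  e : ∀ i j → (i + j) * + 1 ≡ (i * + 1 + j * + 1) * + 1
  e = solve-∀

ι-homo-* : ∀ i j → ι (i * j) ≡ ι i ℚ.* ι j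
ι-homo-* i j = ℚ.toℚᵘ-injective (begin
  toℚᵘ (ι (i * j))                  ≈⟨ toℚᵘ-/ (i * j) 1 ⟩
  (i * j) ℚᵘ./ 1                    ≈⟨ ℚᵘ.*≡* refl ⟩
  (i ℚᵘ./ 1) ℚᵘ.* (j ℚᵘ./ 1)        ≈⟨ ℚᵘ.*-cong (toℚᵘ-/ i 1) (toℚᵘ-/ j 1) ⟨
  toℚᵘ (ι i) ℚᵘ.* toℚᵘ (ι j)        ≈⟨ ℚ.toℚᵘ-homo-* (ι i) (ι j) ⟨
  toℚᵘ (ι i ℚ.* ι j)                ∎)
  where
  open import Relation.Binary.Reasoning.Setoid ℚᵘ.≃-setoid

ι-homo-- : ∀ i j → ι (i - j) ≡ ι i ℚ.- ι j
ι-homo-- i j = begin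
  ι (i - j)                     ≡⟨ e₁ (ι (i - j)) (ι j) ⟩
  ι (i - j) ℚ.+ ι j ℚ.- ι j     ≡⟨ cong (ℚ._- ι j) (ι-homo-+ (i - j) j) ⟨
  ι (i - j + j) ℚ.- ι j         ≡⟨ cong (λ t → ι t ℚ.- ι j) (e₂ i j) ⟩
  ι i ℚ.- ι j                   ∎
  where
  open ≡-Reasoning
  open +-*-Solver
  e₁ : ∀ x y → x ≡ x ℚ.+ y ℚ.- y
  e₁ = solve 2 (λ x y → x := x :+ y :- y) refl
  e₂ : ∀ i j → i - j + j ≡ i
  e₂ = solve-∀

/-*-cancel : ∀ i d .{{_ : NonZero d}} → (i ℚ./ d) ℚ.* ι (+ d) ≡ ι i
/-*-cancel i d@(suc d-1) = ℚ.toℚᵘ-injective (begin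
  toℚᵘ ((i ℚ./ d) ℚ.* ι (+ d))             ≈⟨ ℚ.toℚᵘ-homo-* (i ℚ./ d) (ι (+ d)) ⟩
  toℚᵘ (i ℚ./ d) ℚᵘ.* toℚᵘ (ι (+ d))     ≈⟨ ℚᵘ.*-cong (toℚᵘ-/ i d) (toℚᵘ-/ (+ d) 1) ⟩
  (i ℚᵘ./ d) ℚᵘ.* (+ d ℚᵘ./ 1)               ≈⟨ ℚᵘ.*≡* (trans (ℤ.*-identityʳ (i * + d)) (cong (λ t → i * + t) (sym (ℕ.*-identityʳ d)))) ⟩
  i ℚᵘ./ 1                               ≈⟨ toℚᵘ-/ i 1 ⟨
  toℚᵘ (ι i)                             ∎)
  where
  open import Relation.Binary.Reasoning.Setoid ℚᵘ.≃-setoid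

ι-cancel-≤ : ∀ {i j} → ι i ℚ.≤ ι j → i ≤ j
ι-cancel-≤ {i} {j} p = subst₂ _≤_ (ℤ.*-identityʳ i) (ℤ.*-identityʳ j)
  (ℚᵘ.drop-*≤* (ℚᵘ.≤-respˡ-≃ (toℚᵘ-/ i 1) (ℚᵘ.≤-respʳ-≃ (toℚᵘ-/ j 1) (ℚ.toℚᵘ-mono-≤ p))))

ι-cancel-< : ∀ {i j} → ι i ℚ.< ι j → i < j
ι-cancel-< {i} {j} p = subst₂ _<_ (ℤ.*-identityʳ i) (ℤ.*-identityʳ j)
  (ℚᵘ.drop-*<* (ℚᵘ.<-respˡ-≃ (toℚᵘ-/ i 1) (ℚᵘ.<-respʳ-≃ (toℚᵘ-/ j 1) (ℚ.toℚᵘ-mono-< p))))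

ι-mono-≤ : ∀ {i j} → i ≤ j → ι i ℚ.≤ ι j
ι-mono-≤ {i} {j} p = ℚ.toℚᵘ-cancel-≤ (ℚᵘ.≤-respˡ-≃ (ℚᵘ.≃-sym (toℚᵘ-/ i 1)) (ℚᵘ.≤-respʳ-≃ (ℚᵘ.≃-sym (toℚᵘ-/ j 1))
  (ℚᵘ.*≤* (subst₂ _≤_ (sym (ℤ.*-identityʳ i)) (sym (ℤ.*-identityʳ j)) p))))

ι-mono-< : ∀ {i j} → i < j → ι i ℚ.< ι j
ι-mono-< {i} {j} p = ℚ.toℚᵘ-cancel-< (ℚᵘ.<-respˡ-≃ (ℚᵘ.≃-sym (toℚᵘ-/ i 1)) (ℚᵘ.<-respʳ-≃ (ℚᵘ.≃-sym (toℚᵘ-/ j 1))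
  (ℚᵘ.*<* (subst₂ _<_ (sym (ℤ.*-identityʳ i)) (sym (ℤ.*-identityʳ j)) p))))

p<1+floor : ∀ p → p ℚ.< ι (floor p + + 1)
p<1+floor p@record{} = ℚ.toℚᵘ-cancel-< (ℚᵘ.<-respʳ-≃ (ℚᵘ.≃-sym (toℚᵘ-/ (floor p + + 1) 1)) (ℚᵘ.*<* (begin-strict
  ↥ p * + 1                              ≡⟨ ℤ.*-identityʳ (↥ p) ⟩
  ↥ p                                    <⟨ n<s[n/ℕd]*d (↥ p) (ℚ.↧ₙ p) ⟩
  ℤ.suc (↥ p ℤ./ℕ ℚ.↧ₙ p) * ↧ p          ≡⟨ cong (λ t → ℤ.suc t * ↧ p) (div-pos-is-/ℕ (↥ p) (ℚ.↧ₙ p)) ⟨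
  ℤ.suc (floor p) * ↧ p                  ≡⟨ cong (_* ↧ p) (ℤ.+-comm (+ 1) (floor p)) ⟩
  (floor p + + 1) * ↧ p                  ∎)))
  where open ℤ.≤-Reasoning

private
  4ℚ = ι (+ 4)
  2ℚ = ι (+ 2)

scaled-≤ : ∀ {p q i j} → 4ℚ ℚ.* p ≡ ι i → 4ℚ ℚ.* q ≡ ι j → p ℚ.≤ q → i ≤ j
scaled-≤ ep eq p≤q = ι-cancel-≤ (subst₂ ℚ._≤_ ep eq (ℚ.*-monoˡ-≤-nonNeg 4ℚ p≤q))

scaled-< : ∀ {p q i j} → 4ℚ ℚ.* p ≡ ι i → 4ℚ ℚ.* q ≡ ι j → p ℚ.< q → i < j
scaled-< ep eq p<q = ι-cancel-< (subst₂ ℚ._<_ ep eq (ℚ.*-monoʳ-<-pos 4ℚ p<q))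

-- g = ⌊(√x - A) / 2⌋, i.e. IsFloorSqrtMinus (x / 4) (A / 2) g with denominators cleared.
IsFloorℤ : ℤ → ℤ → ℤ → Set
IsFloorℤ A x g = let G = + 2 * g + A in
  (G ≤ 0ℤ ⊎ G * G ≤ x) × 0ℤ < G + + 2 × x < (G + + 2) * (G + + 2)

-- With G = 2 (g + h), squares need the factor 4. The linear conditions are scaled by the same 4,
-- which leaves a surplus 2 to cancel in `drop4` and `lower`.
floorSqrt-ℤ : ∀ {X h g} A x → h ≡ ι A ℚ.* ½ → 4ℚ ℚ.* X ≡ ι x
  → IsFloorSqrtMinus X h g → IsFloorℤ A x g
floorSqrt-ℤ {X} {h} {g} A x refl 4X (_ , low , pos , up) = lower low , drop4 (scaled-< refl 4G+4 pos) , scaled-< 4X 4[G+1]² up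
  where
  G = + 2 * g + A
  open +-*-Solver
  2G : ι G ≡ 2ℚ ℚ.* (ι g ℚ.+ h)
  2G = trans (ι-homo-+ (+ 2 * g) A) (trans (cong (ℚ._+ ι A) (ι-homo-* (+ 2) g))
    (solve 2 (λ g A → con 2ℚ :* g :+ A := con 2ℚ :* (g :+ A :* con ½)) refl (ι g) (ι A)))
  2G+2 : ι (G + + 2) ≡ 2ℚ ℚ.* (ι g ℚ.+ h ℚ.+ 1ℚ)
  2G+2 = trans (ι-homo-+ G (+ 2)) (trans (cong (ℚ._+ 2ℚ) 2G)
    (solve 1 (λ y → con 2ℚ :* y :+ con 2ℚ := con 2ℚ :* (y :+ con 1ℚ)) refl (ι g ℚ.+ h)))
  square : ∀ i p → ι i ≡ 2ℚ ℚ.* p → 4ℚ ℚ.* (p ℚ.* p) ≡ ι (i * i)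
  square i p eq = sym (trans (ι-homo-* i i) (trans (cong₂ ℚ._*_ eq eq)
    (solve 1 (λ p → con 2ℚ :* p :* (con 2ℚ :* p) := con 4ℚ :* (p :* p)) refl p)))
  double : ∀ i p → ι i ≡ 2ℚ ℚ.* p → 4ℚ ℚ.* p ≡ ι (+ 2 * i)
  double i p eq = sym (trans (ι-homo-* (+ 2) i) (trans (cong (2ℚ ℚ.*_) eq)
    (solve 1 (λ p → con 2ℚ :* (con 2ℚ :* p) := con 4ℚ :* p) refl p)))
  4G+4 = double (G + + 2) (ι g ℚ.+ h ℚ.+ 1ℚ) 2G+2
  4[G+1]² = square (G + + 2) (ι g ℚ.+ h ℚ.+ 1ℚ) 2G+2
  drop4 : 0ℤ < + 2 * (G + + 2) → 0ℤ < G + + 2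
  drop4 = ℤ.*-cancelˡ-<-nonNeg {0ℤ} (+ 2)
  lower : _ → _
  lower (inj₁ G≤0)  = inj₁ (ℤ.*-cancelˡ-≤-pos G 0ℤ (+ 2) (scaled-≤ (double G (ι g ℚ.+ h) 2G) refl G≤0))
  lower (inj₂ G²≤X) = inj₂ (scaled-≤ (square G (ι g ℚ.+ h) 2G) 4X G²≤X)

private
  α≡ : ∀ a b c → α a b c ≡ ι (+ (a ℕ.+ b ℕ.+ c)) ℚ.* ½
  α≡ a b c = begin
    h                      ≡⟨ solve 1 (λ x → x := x :* con 2ℚ :* con ½) refl h ⟩
    h ℚ.* 2ℚ ℚ.* ½         ≡⟨ cong (ℚ._* ½) (/-*-cancel (+ (a ℕ.+ b ℕ.+ c)) 2) ⟩
    ι (+ (a ℕ.+ b ℕ.+ c)) ℚ.* ½  ∎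
    where
    open ≡-Reasoning
    open +-*-Solver
    h = α a b c

  -- A′ is A or - A.
  radicand : ∀ A A′ B k → 4ℚ ℚ.* (ι B ℚ.* (ι k ℚ.+ ι A′ ℚ.* ½) ℚ.+ ι A ℚ.* ½ ℚ.* (ι A ℚ.* ½))
    ≡ ι (+ 2 * B * (+ 2 * k + A′) + A * A)
  radicand A A′ B k
    rewrite ι-homo-+ (+ 2 * B * (+ 2 * k + A′)) (A * A)
          | ι-homo-* (+ 2 * B) (+ 2 * k + A′) | ι-homo-* (+ 2) B
          | ι-homo-+ (+ 2 * k) A′ | ι-homo-* (+ 2) k | ι-homo-* A A
    = solve 4 (λ A A′ B k → con 4ℚ :* (B :* (k :+ A′ :* con ½) :+ A :* con ½ :* (A :* con ½))
                := con 2ℚ :* B :* (con 2ℚ :* k :+ A′) :+ A :* A) refl (ι A) (ι A′) (ι B) (ι k)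
    where open +-*-Solver

  -- Multiplies the argument of the floor in `M` by 4β. The reciprocal `w` enters only through w ·
  -- 4B = 1, so that the ring solver meets no division.
  threshold : ∀ A B w h → h ≡ ι A ℚ.* ½ → w ℚ.* ι (+ 4 * B) ≡ 1ℚ
    → let t = 2ℚ ℚ.* h ℚ.* ι B in
      (((t ℚ.- 1ℚ) ℚ.* (t ℚ.- 1ℚ) ℚ.- 4ℚ ℚ.* h ℚ.* h) ℚ.* w ℚ.+ h) ℚ.* ι (+ 4 * B)
      ≡ ι ((A * B - + 1) * (A * B - + 1) - A * A + + 2 * A * B)
  threshold A B w h h≡ wF = begin
    (D ℚ.* w ℚ.+ h) ℚ.* F            ≡⟨ solve 4 (λ D w h F → (D :* w :+ h) :* F := D :* (w :* F) :+ h :* F) refl D w h F ⟩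
    D ℚ.* (w ℚ.* F) ℚ.+ h ℚ.* F      ≡⟨ cong₂ ℚ._+_ (trans (cong (D ℚ.*_) wF) (trans (ℚ.*-identityʳ D) D≡)) hF ⟩
    ι (u * u - A * A) ℚ.+ ι (+ 2 * A * B) ≡⟨ ι-homo-+ (u * u - A * A) (+ 2 * A * B) ⟨
    ι (u * u - A * A + + 2 * A * B)  ∎
    where
    open ≡-Reasoning
    open +-*-Solver
    t = 2ℚ ℚ.* h ℚ.* ι B
    D = (t ℚ.- 1ℚ) ℚ.* (t ℚ.- 1ℚ) ℚ.- 4ℚ ℚ.* h ℚ.* h
    F = ι (+ 4 * B)
    u = A * B - + 1
    t≡ : t ≡ ι (A * B)
    t≡ = trans (cong (λ h → 2ℚ ℚ.* h ℚ.* ι B) h≡)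
      (trans (solve 2 (λ A B → con 2ℚ :* (A :* con ½) :* B := A :* B) refl (ι A) (ι B)) (sym (ι-homo-* A B)))
    u≡ : t ℚ.- 1ℚ ≡ ι u
    u≡ = trans (cong (ℚ._- 1ℚ) t≡) (sym (ι-homo-- (A * B) (+ 1)))
    4h² : 4ℚ ℚ.* h ℚ.* h ≡ ι (A * A)
    4h² = trans (cong (λ h → 4ℚ ℚ.* h ℚ.* h) h≡)
      (trans (solve 1 (λ A → con 4ℚ :* (A :* con ½) :* (A :* con ½) := A :* A) refl (ι A)) (sym (ι-homo-* A A)))
    D≡ : D ≡ ι (u * u - A * A)
    D≡ = trans (cong₂ ℚ._-_ (trans (cong₂ ℚ._*_ u≡ u≡) (sym (ι-homo-* u u))) 4h²) (sym (ι-homo-- (u * u) (A * A)))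
    hF : h ℚ.* F ≡ ι (+ 2 * A * B)
    hF = begin
      h ℚ.* F                          ≡⟨ cong₂ ℚ._*_ h≡ (ι-homo-* (+ 4) B) ⟩
      ι A ℚ.* ½ ℚ.* (4ℚ ℚ.* ι B)       ≡⟨ solve 2 (λ A B → A :* con ½ :* (con 4ℚ :* B) := con 2ℚ :* A :* B) refl (ι A) (ι B) ⟩
      2ℚ ℚ.* ι A ℚ.* ι B               ≡⟨ cong (ℚ._* ι B) (ι-homo-* (+ 2) A) ⟨
      ι (+ 2 * A) ℚ.* ι B              ≡⟨ ι-homo-* (+ 2 * A) B ⟨
      ι (+ 2 * A * B)                  ∎

module _ (a b c : ℕ) where

  private
    A = + (a ℕ.+ b ℕ.+ c)
    B = + (2 ℕ.* a ℕ.* b ℕ.* c)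

  gamma-ℤ : ∀ k {g} → IsGamma a b c k g → IsFloorℤ A (+ 2 * B * (+ 2 * + k + A) + A * A) g
  gamma-ℤ k {g} = floorSqrt-ℤ {g = g} A (+ 2 * B * (+ 2 * + k + A) + A * A) (α≡ a b c)
    (trans (cong (λ h → 4ℚ ℚ.* (ι B ℚ.* (ι (+ k) ℚ.+ h) ℚ.+ h ℚ.* h)) (α≡ a b c)) (radicand A A B (+ k)))

  delta-ℤ : ∀ k {d} → IsDelta a b c k d → IsFloorℤ A (+ 2 * B * (+ 2 * + k - A) + A * A) d
  delta-ℤ k {d} = floorSqrt-ℤ {g = d} A (+ 2 * B * (+ 2 * + k - A) + A * A) (α≡ a b c)
    (trans (cong (λ h → 4ℚ ℚ.* (ι B ℚ.* (ι (+ k) ℚ.- h) ℚ.+ h ℚ.* h)) (α≡ a b c))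
      (trans (cong (λ h → 4ℚ ℚ.* (ι B ℚ.* (ι (+ k) ℚ.+ h) ℚ.+ ι A ℚ.* ½ ℚ.* (ι A ℚ.* ½))) -h)
        (radicand A (ℤ.- A) B (+ k))))
    where
    -h : ℚ.- (ι A ℚ.* ½) ≡ ι (ℤ.- A) ℚ.* ½
    -h = trans (ℚ.neg-distribˡ-* (ι A) ½) (cong (ℚ._* ½) (sym
      (trans (cong ι (sym (ℤ.+-identityˡ (ℤ.- A)))) (trans (ι-homo-- 0ℤ A) (ℚ.+-identityˡ (ℚ.- ι A))))))

  -- The argument of the floor in `M` is strictly below k. Clearing 4B and regrouping makes the
  -- right side four times the radicand of δ, which is the form `floor-gap` consumes.
  M≤k-ℤ : .{{_ : NonZero a}} .{{_ : NonZero b}} .{{_ : NonZero c}} → ∀ k → M a b c ≤ + k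
    → (A * B - + 1) * (A * B - + 1) < + 2 * B * (+ 2 * + k - A) + A * A
  M≤k-ℤ k M≤k = begin-strict
    u * u                                                       ≡⟨ e₁ (u * u) A B ⟩
    u * u - A * A + + 2 * A * B + (A * A - + 2 * A * B)         <⟨ ℤ.+-monoˡ-< (A * A - + 2 * A * B) (ι-cancel-< {u * u - A * A + + 2 * A * B} {+ k * (+ 4 * B)} scaled) ⟩
    + k * (+ 4 * B) + (A * A - + 2 * A * B)                     ≡⟨ e₂ A B (+ k) ⟩
    + 2 * B * (+ 2 * + k - A) + A * A                           ∎
    where
    open ℤ.≤-Reasoning
    u = A * B - + 1
    D = 8 ℕ.* a ℕ.* b ℕ.* c
    instance
      D≢0 : NonZero D
      D≢0 = ℕ.m*n≢0 (8 ℕ.* a ℕ.* b) c {{ℕ.m*n≢0 (8 ℕ.* a) b {{ℕ.m*n≢0 8 a}}}}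
    D≡4B : + D ≡ + 4 * B
    D≡4B = trans (cong +_ (e a b c)) (ℤ.pos-* 4 (2 ℕ.* a ℕ.* b ℕ.* c))
      where
      e : ∀ a b c → 8 ℕ.* a ℕ.* b ℕ.* c ≡ 4 ℕ.* (2 ℕ.* a ℕ.* b ℕ.* c)
      e = ℕ-solve-∀
    w = + 1 ℚ./ D
    h = α a b c
    t = 2ℚ ℚ.* h ℚ.* ι B
    r = ((t ℚ.- 1ℚ) ℚ.* (t ℚ.- 1ℚ) ℚ.- 4ℚ ℚ.* h ℚ.* h) ℚ.* w ℚ.+ h
    F-pos : ℚ.Positive (ι (+ 4 * B))
    F-pos = ℚ.positive (subst (λ z → 0ℚ ℚ.< ι z) D≡4B (ι-mono-< (ℤ.+<+ (ℕ.>-nonZero⁻¹ D))))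
    r<k : r ℚ.< ι (+ k)
    r<k = ℚ.<-≤-trans (p<1+floor r) (ι-mono-≤ M≤k)
    scaled : ι (u * u - A * A + + 2 * A * B) ℚ.< ι (+ k * (+ 4 * B))
    scaled = subst₂ ℚ._<_
      (threshold A B w h (α≡ a b c) (trans (cong (λ z → w ℚ.* ι z) (sym D≡4B)) (/-*-cancel (+ 1) D)))
      (sym (ι-homo-* (+ k) (+ 4 * B)))
      (ℚ.*-monoˡ-<-pos (ι (+ 4 * B)) {{F-pos}} r<k)
    e₁ : ∀ x A B → x ≡ x - A * A + + 2 * A * B + (A * A - + 2 * A * B)
    e₁ = solve-∀
    e₂ : ∀ A B k → k * (+ 4 * B) + (A * A - + 2 * A * B) ≡ + 2 * B * (+ 2 * k - A) + A * A
    e₂ = solve-∀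

-- Integer square roots

square-mono-≤ : ∀ {i j} → 0ℤ ≤ i → i ≤ j → i * i ≤ j * j
square-mono-≤ {i} {j} 0≤i i≤j = ℤ.≤-trans
  (ℤ.*-monoʳ-≤-nonNeg i {{ℤ.nonNegative 0≤i}} i≤j)
  (ℤ.*-monoˡ-≤-nonNeg j {{ℤ.nonNegative (ℤ.≤-trans 0≤i i≤j)}} i≤j)

square-cancel-< : ∀ {i j} → 0ℤ ≤ j → i * i < j * j → i < j
square-cancel-< 0≤j i²<j² = ℤ.≰⇒> λ j≤i → ℤ.<⇒≱ i²<j² (square-mono-≤ 0≤j j≤i)

2i+A<2j+A⇒i<j : ∀ A {i j} → + 2 * i + A < + 2 * j + A → i < j
2i+A<2j+A⇒i<j A {i} {j} p =
  ℤ.≰⇒> λ j≤i → ℤ.<⇒≱ p (ℤ.+-monoˡ-≤ A (ℤ.*-monoˡ-≤-nonNeg (+ 2) j≤i))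

2i+A<2j+A+2⇒i≤j : ∀ A {i j} → + 2 * i + A < + 2 * j + A + + 2 → i ≤ j
2i+A<2j+A+2⇒i≤j A {i} {j} p = ℤ.≮⇒≥ λ j<i → ℤ.<⇒≱ p (begin
  + 2 * j + A + + 2       ≡⟨ e j A ⟩
  + 2 * ℤ.suc j + A       ≤⟨ ℤ.+-monoˡ-≤ A (ℤ.*-monoˡ-≤-nonNeg (+ 2) (ℤ.i<j⇒suc[i]≤j j<i)) ⟩
  + 2 * i + A             ∎)
  where
  open ℤ.≤-Reasoning
  e : ∀ j A → + 2 * j + A + + 2 ≡ + 2 * (+ 1 + j) + A
  e = solve-∀

≤-floor : ∀ {A x g} → IsFloorℤ A x g → ∀ n → let m = + 2 * n + A in m * m ≤ x → n ≤ g
≤-floor {A} (_ , 0<G+2 , x<[G+2]²) n m²≤x =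
  2i+A<2j+A+2⇒i≤j A (square-cancel-< (ℤ.<⇒≤ 0<G+2) (ℤ.≤-<-trans m²≤x x<[G+2]²))

-- If G ≤ 0, squares give no comparison between G and m, and the sign of m decides instead.
floor-< : ∀ {A x g} → IsFloorℤ A x g → ∀ n → let m = + 2 * n + A in 0ℤ < m → x < m * m → g < n
floor-< {A} (inj₁ G≤0  , _) n 0<m x<m² = 2i+A<2j+A⇒i<j A (ℤ.≤-<-trans G≤0 0<m)
floor-< {A} (inj₂ G²≤x , _) n 0<m x<m² =
  2i+A<2j+A⇒i<j A (square-cancel-< (ℤ.<⇒≤ 0<m) (ℤ.≤-<-trans G²≤x x<m²))

-- If γ ≥ δ + 2, then with h = 2(δ+1) + A the squares h² > y and (h+2)² ≤ y + 4D force h < D - 1.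
floor-gap : ∀ {A y D γ δ} → IsFloorℤ A (y + + 4 * D) γ → IsFloorℤ A y δ
  → (D - + 1) * (D - + 1) < y → γ ≤ δ + + 1
floor-gap {A} {y} {D} {γ} {δ} (low , _) (_ , 0<h , y<h²) D²<y = ℤ.≮⇒≥ λ δ+1<γ →
  let h+2≤G = begin
        h + + 2                       ≡⟨ e₁ δ A ⟩
        + 2 * ℤ.suc (δ + + 1) + A     ≤⟨ ℤ.+-monoˡ-≤ A (ℤ.*-monoˡ-≤-nonNeg (+ 2) (ℤ.i<j⇒suc[i]≤j δ+1<γ)) ⟩
        + 2 * γ + A                   ∎
  in absurd h+2≤G low
  where
  open ℤ.≤-Reasoning
  h = + 2 * δ + A + + 2
  G = + 2 * γ + A
  e₁ : ∀ δ A → + 2 * δ + A + + 2 + + 2 ≡ + 2 * (+ 1 + (δ + + 1)) + A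
  e₁ = solve-∀
  e₂ : ∀ h → h * h + + 4 * (h + + 1) ≡ (h + + 2) * (h + + 2)
  e₂ = solve-∀
  0<h+2 : 0ℤ < h + + 2
  0<h+2 = ℤ.+-mono-< 0<h (+<+ ℕ.z<s)
  absurd : h + + 2 ≤ G → (G ≤ 0ℤ ⊎ G * G ≤ y + + 4 * D) → ⊥
  absurd h+2≤G (inj₁ G≤0)  = ℤ.<⇒≱ 0<h+2 (ℤ.≤-trans h+2≤G G≤0)
  absurd h+2≤G (inj₂ G²≤x) = ℤ.<-irrefl refl (begin-strict
    (D - + 1) * (D - + 1)  <⟨ D²<y ⟩
    y                      <⟨ y<h² ⟩
    h * h                  ≤⟨ square-mono-≤ (ℤ.<⇒≤ 0<h) h≤D-1 ⟩
    (D - + 1) * (D - + 1)  ∎)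
    where
    4[h+1]<4D : h * h + + 4 * (h + + 1) < h * h + + 4 * D
    4[h+1]<4D = begin-strict
      h * h + + 4 * (h + + 1)   ≡⟨ e₂ h ⟩
      (h + + 2) * (h + + 2)     ≤⟨ square-mono-≤ (ℤ.<⇒≤ 0<h+2) h+2≤G ⟩
      G * G                     ≤⟨ G²≤x ⟩
      y + + 4 * D               <⟨ ℤ.+-monoˡ-< (+ 4 * D) y<h² ⟩
      h * h + + 4 * D           ∎
    h+1<D : h + + 1 < D
    h+1<D = ℤ.≰⇒> λ D≤h+1 → ℤ.<⇒≱ 4[h+1]<4D (ℤ.+-monoʳ-≤ (h * h) (ℤ.*-monoˡ-≤-nonNeg (+ 4) D≤h+1))
    h≤D-1 : h ≤ D - + 1
    h≤D-1 = begin
      h               ≡⟨ e₃ h ⟩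
      h + + 1 - + 1   ≤⟨ ℤ.+-monoˡ-≤ (ℤ.- + 1) (ℤ.<⇒≤ h+1<D) ⟩
      D - + 1         ∎
      where
      e₃ : ∀ h → h ≡ h + + 1 - + 1
      e₃ = solve-∀

-- Every negative n has 0 solutions and would belong to R_0, so k = 0 has to be excluded. There the
-- right side is A² - 2AB ≤ (AB)² - 2AB = (AB - 1)² - 1.
threshold-positive : ∀ A B → 0ℤ ≤ A → + 1 ≤ B
  → ¬ ((A * B - + 1) * (A * B - + 1) < + 2 * B * (+ 2 * + 0 - A) + A * A)
threshold-positive A B 0≤A 1≤B p = ℤ.<⇒≱ p (begin
  + 2 * B * (+ 2 * + 0 - A) + A * A          ≡⟨ e₁ A B ⟩
  A * A - + 2 * A * B                        ≤⟨ ℤ.+-monoˡ-≤ (ℤ.- (+ 2 * A * B)) (square-mono-≤ 0≤A A≤AB) ⟩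
  A * B * (A * B) - + 2 * A * B              ≤⟨ ℤ.i≤i+j (A * B * (A * B) - + 2 * A * B) (+ 1) ⟩
  A * B * (A * B) - + 2 * A * B + + 1        ≡⟨ e₂ A B ⟩
  (A * B - + 1) * (A * B - + 1)              ∎)
  where
  open ℤ.≤-Reasoning
  A≤AB : A ≤ A * B
  A≤AB = ℤ.≤-trans (ℤ.≤-reflexive (sym (ℤ.*-identityʳ A))) (ℤ.*-monoˡ-≤-nonNeg A {{ℤ.nonNegative 0≤A}} 1≤B)
  e₁ : ∀ A B → + 2 * B * (+ 2 * + 0 - A) + A * A ≡ A * A - + 2 * A * B
  e₁ = solve-∀
  e₂ : ∀ A B → A * B * (A * B) - + 2 * A * B + + 1 ≡ (A * B - + 1) * (A * B - + 1)
  e₂ = solve-∀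

-- From the estimate of N(n) to the bounds by γ and δ

module _ (n A B k : ℕ) where

  private
    pos-2i+j : ∀ i j → + (2 ℕ.* i ℕ.+ j) ≡ + 2 * + i + + j
    pos-2i+j i j = cong (_+ + j) (ℤ.pos-* 2 i)

    pos-square : + ((2 ℕ.* n ℕ.+ A) ℕ.* (2 ℕ.* n ℕ.+ A)) ≡ (+ 2 * + n + + A) * (+ 2 * + n + + A)
    pos-square = trans (ℤ.pos-* (2 ℕ.* n ℕ.+ A) (2 ℕ.* n ℕ.+ A)) (cong₂ _*_ (pos-2i+j n A) (pos-2i+j n A))

    pos-2BX : ∀ X → + (2 ℕ.* B ℕ.* X) ≡ + 2 * + B * + X
    pos-2BX X = trans (ℤ.pos-* (2 ℕ.* B) X) (cong (_* + X) (ℤ.pos-* 2 B))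

  lower-ℤ : (2 ℕ.* n ℕ.+ A) ℕ.* (2 ℕ.* n ℕ.+ A) ℕ.≤ 2 ℕ.* B ℕ.* (2 ℕ.* k ℕ.+ A) ℕ.+ A ℕ.* A
    → (+ 2 * + n + + A) * (+ 2 * + n + + A) ≤ + 2 * + B * (+ 2 * + k + + A) + + A * + A
  lower-ℤ p = subst₂ _≤_ pos-square
    (cong₂ _+_ (trans (pos-2BX (2 ℕ.* k ℕ.+ A)) (cong (+ 2 * + B *_) (pos-2i+j k A))) (ℤ.pos-* A A)) (+≤+ p)

  upper-ℤ : 2 ℕ.* B ℕ.* (2 ℕ.* k) ℕ.+ A ℕ.* A ℕ.< (2 ℕ.* n ℕ.+ A) ℕ.* (2 ℕ.* n ℕ.+ A) ℕ.+ 2 ℕ.* B ℕ.* A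
    → + 2 * + B * (+ 2 * + k - + A) + + A * + A < (+ 2 * + n + + A) * (+ 2 * + n + + A)
  upper-ℤ p = ℤ.≰⇒> λ q → ℤ.<⇒≱ cast (begin
    (+ 2 * + n + + A) * (+ 2 * + n + + A) + + 2 * + B * + A            ≤⟨ ℤ.+-monoˡ-≤ (+ 2 * + B * + A) q ⟩
    + 2 * + B * (+ 2 * + k - + A) + + A * + A + + 2 * + B * + A        ≡⟨ e (+ A) (+ B) (+ k) ⟩
    + 2 * + B * (+ 2 * + k) + + A * + A                                ∎)
    where
    open ℤ.≤-Reasoning
    cast : + 2 * + B * (+ 2 * + k) + + A * + A < (+ 2 * + n + + A) * (+ 2 * + n + + A) + + 2 * + B * + A
    cast = subst₂ _<_ (cong₂ _+_ (trans (pos-2BX (2 ℕ.* k)) (cong (+ 2 * + B *_) (ℤ.pos-* 2 k))) (ℤ.pos-* A A))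
      (cong₂ _+_ pos-square (pos-2BX A)) (+<+ p)
    e : ∀ A B k → + 2 * B * (+ 2 * k - A) + A * A + + 2 * B * A ≡ + 2 * B * (+ 2 * k) + A * A
    e = solve-∀

module _ (a b c : ℕ) .{{_ : NonZero a}} .{{_ : NonZero b}} .{{_ : NonZero c}}
  (a⊥b : gcd a b ≡ 1) (b⊥c : gcd b c ≡ 1) (c⊥a : gcd c a ≡ 1) where

  private
    A = a ℕ.+ b ℕ.+ c
    B = 2 ℕ.* a ℕ.* b ℕ.* c
    X Y : ℕ → ℤ
    X k = + 2 * + B * (+ 2 * + k + + A) + + A * + A
    Y k = + 2 * + B * (+ 2 * + k - + A) + + A * + A
    c⊥b′ : Coprime c b
    c⊥b′ = Coprime.sym (gcd≡1⇒coprime b⊥c)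
    c⊥a′ : Coprime c a
    c⊥a′ = gcd≡1⇒coprime c⊥a
    b⊥a′ : Coprime b a
    b⊥a′ = Coprime.sym (gcd≡1⇒coprime a⊥b)

  -- Completing the square, (2n + A)² = 4 n (n + A) + A², reduces this to four times
  -- `numSolℕ-lower`.
  solution-≤-X : ∀ n → let m = + 2 * + n + + A in m * m ≤ X (numSolℕ a b c n)
  solution-≤-X n = lower-ℤ n A B N (begin
    (2 ℕ.* n ℕ.+ A) ℕ.* (2 ℕ.* n ℕ.+ A)                        ≡⟨ e₁ n a b c ⟩
    4 ℕ.* (n ℕ.* (n ℕ.+ (a ℕ.+ (b ℕ.+ c)))) ℕ.+ A ℕ.* A        ≤⟨ ℕ.+-monoˡ-≤ (A ℕ.* A) (ℕ.*-monoʳ-≤ 4 (numSolℕ-lower c⊥b′ c⊥a′ b⊥a′ n)) ⟩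
    4 ℕ.* (2 ℕ.* (a ℕ.* (b ℕ.* c) ℕ.* N) ℕ.+ a ℕ.* (b ℕ.* c) ℕ.* (a ℕ.+ (b ℕ.+ c))) ℕ.+ A ℕ.* A ≡⟨ e₂ a b c N ⟩
    2 ℕ.* B ℕ.* (2 ℕ.* N ℕ.+ A) ℕ.+ A ℕ.* A                    ∎)
    where
    open ℕ.≤-Reasoning
    N = numSolℕ a b c n
    e₁ : ∀ n a b c → (2 ℕ.* n ℕ.+ (a ℕ.+ b ℕ.+ c)) ℕ.* (2 ℕ.* n ℕ.+ (a ℕ.+ b ℕ.+ c))
      ≡ 4 ℕ.* (n ℕ.* (n ℕ.+ (a ℕ.+ (b ℕ.+ c)))) ℕ.+ (a ℕ.+ b ℕ.+ c) ℕ.* (a ℕ.+ b ℕ.+ c)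
    e₁ = ℕ-solve-∀
    e₂ : ∀ a b c N → 4 ℕ.* (2 ℕ.* (a ℕ.* (b ℕ.* c) ℕ.* N) ℕ.+ a ℕ.* (b ℕ.* c) ℕ.* (a ℕ.+ (b ℕ.+ c))) ℕ.+ (a ℕ.+ b ℕ.+ c) ℕ.* (a ℕ.+ b ℕ.+ c)
      ≡ 2 ℕ.* (2 ℕ.* a ℕ.* b ℕ.* c) ℕ.* (2 ℕ.* N ℕ.+ (a ℕ.+ b ℕ.+ c)) ℕ.+ (a ℕ.+ b ℕ.+ c) ℕ.* (a ℕ.+ b ℕ.+ c)
    e₂ = ℕ-solve-∀

  Y-<-solution : ∀ n → let m = + 2 * + n + + A in Y (numSolℕ a b c n) < m * m
  Y-<-solution n = upper-ℤ n A B N (begin-strict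
    2 ℕ.* B ℕ.* (2 ℕ.* N) ℕ.+ A ℕ.* A                          ≡⟨ e₁ a b c N (A ℕ.* A) ⟩
    4 ℕ.* (2 ℕ.* (a ℕ.* (b ℕ.* c) ℕ.* N)) ℕ.+ A ℕ.* A          <⟨ ℕ.+-monoˡ-< (A ℕ.* A) (ℕ.*-monoʳ-< 4 (numSolℕ-upper c⊥b′ c⊥a′ b⊥a′ n)) ⟩
    4 ℕ.* (n ℕ.* (n ℕ.+ (a ℕ.+ (b ℕ.+ c))) ℕ.+ a ℕ.* (b ℕ.* c) ℕ.* (a ℕ.+ (b ℕ.+ c))) ℕ.+ A ℕ.* A ≡⟨ e₂ n a b c ⟩
    (2 ℕ.* n ℕ.+ A) ℕ.* (2 ℕ.* n ℕ.+ A) ℕ.+ 2 ℕ.* B ℕ.* A      ∎)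
    where
    open ℕ.≤-Reasoning
    N = numSolℕ a b c n
    e₁ : ∀ a b c N x → 2 ℕ.* (2 ℕ.* a ℕ.* b ℕ.* c) ℕ.* (2 ℕ.* N) ℕ.+ x ≡ 4 ℕ.* (2 ℕ.* (a ℕ.* (b ℕ.* c) ℕ.* N)) ℕ.+ x
    e₁ = ℕ-solve-∀
    e₂ : ∀ n a b c → 4 ℕ.* (n ℕ.* (n ℕ.+ (a ℕ.+ (b ℕ.+ c))) ℕ.+ a ℕ.* (b ℕ.* c) ℕ.* (a ℕ.+ (b ℕ.+ c))) ℕ.+ (a ℕ.+ b ℕ.+ c) ℕ.* (a ℕ.+ b ℕ.+ c)
      ≡ (2 ℕ.* n ℕ.+ (a ℕ.+ b ℕ.+ c)) ℕ.* (2 ℕ.* n ℕ.+ (a ℕ.+ b ℕ.+ c)) ℕ.+ 2 ℕ.* (2 ℕ.* a ℕ.* b ℕ.* c) ℕ.* (a ℕ.+ b ℕ.+ c)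
    e₂ = ℕ-solve-∀

  module _ (k : ℕ) (M≤k : M a b c ≤ + k) (γ δ : ℤ) (γ-def : IsGamma a b c k γ) (δ-def : IsDelta a b c k δ) where

    -- The fourfold radicands differ by 4AB, so `floor-gap` applies with D = AB, that is 2αβ, and
    -- `M≤k-ℤ` is exactly its hypothesis.
    γ≤δ+1 : γ ≤ δ + + 1
    γ≤δ+1 = floor-gap {+ A} {Y k} {+ A * + B} {γ} {δ}
      (subst (λ x → IsFloorℤ (+ A) x γ) (e (+ A) (+ B) (+ k)) (gamma-ℤ a b c k {γ} γ-def))
      (delta-ℤ a b c k {δ} δ-def) (M≤k-ℤ a b c k M≤k)
      where
      e : ∀ A B k → + 2 * B * (+ 2 * k + A) + A * A ≡ + 2 * B * (+ 2 * k - A) + A * A + + 4 * (A * B)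
      e = solve-∀

    InR⇒bounds : ∀ n → InR a b c k n → δ < n × n ≤ γ
    InR⇒bounds (+ n) refl =
        floor-< {+ A} {Y k} {δ} (delta-ℤ a b c k {δ} δ-def) (+ n) 0<m (Y-<-solution n)
      , ≤-floor {+ A} {X k} {γ} (gamma-ℤ a b c k {γ} γ-def) (+ n) (solution-≤-X n)
      where
      0<m : 0ℤ < + 2 * + n + + A
      0<m = subst (0ℤ <_) (cong (_+ + A) (ℤ.pos-* 2 n))
        (+<+ (ℕ.<-≤-trans (ℕ.>-nonZero⁻¹ a)
          (ℕ.≤-trans (ℕ.≤-trans (ℕ.m≤m+n a b) (ℕ.m≤m+n (a ℕ.+ b) c)) (ℕ.m≤n+m A (2 ℕ.* n)))))
    -- Matching `refl` sets k to 0, which M ≤ k does not allow.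
    InR⇒bounds -[1+ n ] refl = contradiction (M≤k-ℤ a b c 0 M≤k) (threshold-positive (+ A) (+ B) (+≤+ ℕ.z≤n) (+≤+ B≥1))
      where
      B≥1 : 1 ℕ.≤ B
      B≥1 = ℕ.*-mono-≤ (ℕ.*-mono-≤ (ℕ.*-mono-≤ {1} {2} (ℕ.s≤s ℕ.z≤n) (ℕ.>-nonZero⁻¹ a)) (ℕ.>-nonZero⁻¹ b)) (ℕ.>-nonZero⁻¹ c)

    -- The chain δ + 1 ≤ n ≤ γ ≤ δ + 1 collapses.
    InR⇒≡γ : ∀ n → InR a b c k n → n ≡ γ
    InR⇒≡γ n n∈R with δ<n , n≤γ ← InR⇒bounds n n∈R =
      ℤ.≤-antisym n≤γ (ℤ.≤-trans γ≤δ+1 (subst (_≤ n) (ℤ.+-comm (+ 1) δ) (ℤ.i<j⇒suc[i]≤j δ<n)))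

theorem3 : (a b c : ℕ) → .{{_ : NonZero a}} → .{{_ : NonZero b}} → .{{_ : NonZero c}}
    → gcd a b ≡ 1 → gcd b c ≡ 1 → gcd c a ≡ 1
    → (k : ℕ) → + k ≥ M a b c
    → (γ δ : ℤ) → IsGamma a b c k γ → IsDelta a b c k δ
    → (γ ≡ δ → ∀ (n : ℤ) → ¬ InR a b c k n)
    × (γ ≢ δ
    → (numSol a b c γ ≡ k → ∀ (n : ℤ) → (InR a b c k n ⇔ n ≡ γ))
    × (numSol a b c γ ≢ k → ∀ (n : ℤ) → ¬ InR a b c k n))
theorem3 a b c a⊥b b⊥c c⊥a k k≥M γ δ γ-def δ-def =
    (λ { refl n n∈R → let δ<n , n≤γ = bounds n n∈R in ℤ.<⇒≱ δ<n n≤γ })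
  , λ _ → (λ γ∈R n → mk⇔ (unique n) (λ { refl → γ∈R }))
        , (λ γ∉R n n∈R → γ∉R (subst (InR a b c k) (unique n n∈R) n∈R))
  where
  bounds = InR⇒bounds a b c a⊥b b⊥c c⊥a k k≥M γ δ γ-def δ-def
  unique = InR⇒≡γ a b c a⊥b b⊥c c⊥a k k≥M γ δ γ-def δ-def
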